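{- There exists a function $f \colon \mathbb{N} \to \{\pm 1\}$ with the following properties: (1) for every prime $p$, the set $\{ n \in \mathbb{N} : f(n) \neq -f(pn)\}$ has natural density $0$; (2) there exists $\varepsilon > 0$ such that for all sufficiently large $x$, \[ \frac{1}{x} \sum_{n \leq x} f(n) f(n+1) < -\varepsilon ; \] (3) \[ \lim_{H \to \infty} \lim_{x \to \infty} \frac{1}{x} \sum_{n \leq x} \left| \frac{1}{H} \sum_{h \leq H} f(n+h)\, \mathbb{1}_{n+h \equiv 1 \bmod 3} \right| = \frac{1}{3}. \]
   Context: The natural density of $A \subseteq \mathbb{N}$ is $\lim_{x\to\infty} |A\cap[1,x]|/x$. Sums $\sum_{n \le x}$ and $\sum_{h \le H}$ run over positive integers. $\mathbb{1}_{P}$ equals $1$ if the condition $P$ holds and $0$ otherwise. -}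

module Defs where

open import Data.Nat as ℕ using (ℕ; zero; suc; _≥_; _%_)
open import Data.Integer as ℤ using (ℤ; +_)
open import Data.Rational as ℚ using (ℚ; 0ℚ; 1ℚ; _<_; _+_; _*_; _-_; ∣_∣)
open import Data.Sign as Sign using (Sign)
open import Data.Bool using (Bool; true; false; if_then_else_)
open import Data.Product using (Σ; ∃; _×_)
open import Relation.Nullary using (does; ¬_)

⟦_⟧ : Sign → ℚ
⟦ Sign.+ ⟧ = 1ℚ
⟦ Sign.- ⟧ = ℚ.- 1ℚ

sumTo : ℕ → (ℕ → ℚ) → ℚ
sumTo zero    g = 0ℚ
sumTo (suc x) g = sumTo x g + g (suc x)

-- avg x g = (1/x) Σ_{1 ≤ n ≤ x} g n   (convention: 0 for x = 0, never used in limits)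
avg : ℕ → (ℕ → ℚ) → ℚ
avg zero    g = 0ℚ
avg (suc k) g = sumTo (suc k) g * (+ 1 ℚ./ suc k)

𝟙 : Bool → ℚ
𝟙 b = if b then 1ℚ else 0ℚ

ConvergesTo : (ℕ → ℚ) → ℚ → Set
ConvergesTo a L = ∀ (ε : ℚ) → 0ℚ < ε → ∃ λ X → ∀ x → x ≥ X → ∣ a x - L ∣ < ε

Cauchy : (ℕ → ℚ) → Set
Cauchy a = ∀ (ε : ℚ) → 0ℚ < ε → ∃ λ X → ∀ x y → x ≥ X → y ≥ X → ∣ a x - a y ∣ < ε

Density0 : (ℕ → Bool) → Set
Density0 A = ConvergesTo (λ x → avg x (λ n → 𝟙 (A n))) 0ℚ

badSet : (ℕ → Sign) → ℕ → ℕ → Bool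
badSet f p n = if does (f n Sign.≟ Sign.opposite (f (p ℕ.* n))) then false else true

f₃ : (ℕ → Sign) → ℕ → ℚ
f₃ f m = if does (m % 3 ℕ.≟ 1) then ⟦ f m ⟧ else 0ℚ

inner : (ℕ → Sign) → ℕ → ℕ → ℚ
inner f H x = avg x (λ n → ∣ avg H (λ h → f₃ f (n ℕ.+ h)) ∣)

-- lim_{H→∞} lim_{x→∞} inner f H x = L, where both limits are asserted to exist:
-- each inner sequence is Cauchy (so its limit L_H exists in ℝ), and L_H → L.
IteratedLimit : (ℕ → ℕ → ℚ) → ℚ → Set
IteratedLimit a L =
  (∀ H → Cauchy (a H)) ×
  (∀ (ε : ℚ) → 0ℚ < ε → ∃ λ H₀ → ∀ H → H ≥ H₀ →
     ∃ λ X → ∀ x → x ≥ X → ∣ a H x - L ∣ < ε)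

{-# OPTIONS --safe #-}
module Submission where

-- Put f = κ S, where κ is completely multiplicative with κ(p) = χ₃(p) for p ≠ 3 and κ(3) = −1, and where S is
-- locally constant and satisfies S(pn) = ψ(p) S(n), ψ(p) = −κ(p), both up to density 0. Then f(pn) = −f(n);
-- f(n) f(n+1) averages like κ(n) κ(n+1), to −1/3; and f equals S on 1 mod 3, so short windows see a constant sign.
--
-- S is built from sets E_q = {n : ⌊n/(qP)⌋ mod B = D}, q ∣ D, which satisfy n ∈ E_q ⇔ pn ∈ E_{pq} and, for B large,
-- are pairwise disjoint. The sign ψ(q) on E_q is therefore a partial solution of S(pn) = ψ(p) S(n) that fails only
-- on the faces of the exponent box {q : q ∣ D}, a proportion 1/(j+1) of its domain if p^(j+1) ∣ D. Rerunning this
-- at rapidly growing, hence independent, scales P, with the newest mark overriding older ones, leaves at any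
-- further step a proportion of bad n that is a convex combination of the previous one and O(1/j); as the domains
-- have divergent total density but each is sparse, the failure density tends to 0 while consecutive approximants
-- differ rarely. So one can switch from each approximant to the next at sparse thresholds.

open import Defs
open import Data.Bool using (Bool; true; false; not; _∧_; _∨_; if_then_else_)
open import Data.Product using (Σ; ∃; ∃₂; _×_; _,_; proj₁; proj₂)
open import Data.Sign as Sign using (Sign)
open import Data.Sum using (_⊎_; inj₁; inj₂)
open import Relation.Nullary using (¬_; yes; no; contradiction; does; Dec)
open import Relation.Nullary.Decidable using (dec-true; dec-false)
open import Relation.Binary.PropositionalEquality
import Data.Sign.Properties as Sign

-- The sets E_q form a Rokhlin-type tower for the action of multiplication: the divisors of `D` are
-- a Følner box, nearly invariant under each small prime, and E_q is the level with label `q`.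
-- Disjointness needs a base `B` larger than D², so one tower covers only the proportion d(D)/B of
-- the integers and many towers must be superposed. Independence of the scales keeps them from
-- spoiling one another: new marks override good and bad points in the same proportion. Two demands
-- pull on the stage `j`. Raising it makes the faces and the domains thin, but domains that thin too
-- fast would have summable densities and would leave old errors in place. So `j` is raised only
-- once the number of steps has caught up with the base `B`, and the densities dominate a harmonic
-- series. The failure rate of an approximant is known only over its full periods; hence the final
-- sign uses it only from a threshold far beyond its period.

module Construction where

  open import Data.Bool.Properties using (∧-zeroʳ; ∧-identityʳ)
  open import Data.List using (List; []; _∷_)
  import Data.List.Relation.Binary.Permutation.Propositional as Perm
  open import Data.List.Relation.Unary.All using (_∷_)
  open import Data.Maybe as Maybe using (Maybe; just; nothing; is-just; fromMaybe)
  import Data.Maybe.Properties as Maybe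
  open import Data.Nat
  open import Data.Nat.Properties
  open import Data.Nat.Divisibility
  open import Data.Nat.DivMod using (m≡m%n+[m/n]*n; m%n<n; %-distribˡ-*)
  open import Data.Nat.ListAction using (product)
  open import Data.Nat.Primality using (Prime; euclidsLemma; prime⇒nonZero)
  open import Data.Nat.Primality.Factorisation using (PrimeFactorisation; factorise; factorisationUnique)
  open import Data.Nat.Tactic.RingSolver using (solve-∀)

  -- Finite sums and counts of natural numbers

  does-true : ∀ {a} {A : Set a} (d : Dec A) → does d ≡ true → A
  does-true (yes p) _ = p

  Σ< : ℕ → (ℕ → ℕ) → ℕ
  Σ< zero    g = 0
  Σ< (suc x) g = Σ< x g + g x

  𝕀 : Bool → ℕ
  𝕀 b = if b then 1 else 0

  # : (ℕ → Bool) → ℕ → ℕ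
  # A x = Σ< x (λ n → 𝕀 (A n))

  𝕀≤1 : ∀ b → 𝕀 b ≤ 1
  𝕀≤1 true  = ≤-refl
  𝕀≤1 false = z≤n

  Σ<-cong : ∀ x {g h} → (∀ n → n < x → g n ≡ h n) → Σ< x g ≡ Σ< x h
  Σ<-cong zero    eq = refl
  Σ<-cong (suc x) eq = cong₂ _+_ (Σ<-cong x λ n n<x → eq n (m<n⇒m<1+n n<x)) (eq x ≤-refl)

  Σ<-mono : ∀ x {g h} → (∀ n → n < x → g n ≤ h n) → Σ< x g ≤ Σ< x h
  Σ<-mono zero    le = z≤n
  Σ<-mono (suc x) le = +-mono-≤ (Σ<-mono x λ n n<x → le n (m<n⇒m<1+n n<x)) (le x ≤-refl)

  Σ<-+ : ∀ x g h → Σ< x (λ n → g n + h n) ≡ Σ< x g + Σ< x h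
  Σ<-+ zero    g h = refl
  Σ<-+ (suc x) g h = begin
    Σ< x (λ n → g n + h n) + (g x + h x) ≡⟨ cong (_+ (g x + h x)) (Σ<-+ x g h) ⟩
    Σ< x g + Σ< x h + (g x + h x)        ≡⟨ interchange (Σ< x g) (Σ< x h) (g x) (h x) ⟩
    Σ< x g + g x + (Σ< x h + h x)        ∎
    where
    open ≡-Reasoning
    interchange : ∀ a b c d → a + b + (c + d) ≡ a + c + (b + d)
    interchange = solve-∀

  Σ<-*ˡ : ∀ x c g → Σ< x (λ n → c * g n) ≡ c * Σ< x g
  Σ<-*ˡ zero    c g = sym (*-zeroʳ c)
  Σ<-*ˡ (suc x) c g = trans (cong (_+ c * g x) (Σ<-*ˡ x c g)) (sym (*-distribˡ-+ c (Σ< x g) (g x)))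

  Σ<-*ʳ : ∀ x c g → Σ< x (λ n → g n * c) ≡ Σ< x g * c
  Σ<-*ʳ x c g = trans (Σ<-cong x λ n _ → *-comm (g n) c) (trans (Σ<-*ˡ x c g) (*-comm c (Σ< x g)))

  Σ<-const : ∀ x c → Σ< x (λ _ → c) ≡ x * c
  Σ<-const zero    c = refl
  Σ<-const (suc x) c = trans (cong (_+ c) (Σ<-const x c)) (+-comm (x * c) c)

  Σ<-swap : ∀ x y (g : ℕ → ℕ → ℕ) → Σ< x (λ m → Σ< y (g m)) ≡ Σ< y (λ n → Σ< x (λ m → g m n))
  Σ<-swap zero    y g = sym (trans (Σ<-const y 0) (*-zeroʳ y))
  Σ<-swap (suc x) y g = trans (cong (_+ Σ< y (g x)) (Σ<-swap x y g))
                              (sym (Σ<-+ y (λ n → Σ< x (λ m → g m n)) (g x)))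

  Σ<-split : ∀ x y g → Σ< (x + y) g ≡ Σ< x g + Σ< y (λ n → g (x + n))
  Σ<-split x zero    g = trans (cong (λ z → Σ< z g) (+-identityʳ x)) (sym (+-identityʳ (Σ< x g)))
  Σ<-split x (suc y) g = begin
    Σ< (x + suc y) g                                    ≡⟨ cong (λ z → Σ< z g) (+-suc x y) ⟩
    Σ< (x + y) g + g (x + y)                            ≡⟨ cong (_+ g (x + y)) (Σ<-split x y g) ⟩
    Σ< x g + Σ< y (λ n → g (x + n)) + g (x + y)         ≡⟨ +-assoc (Σ< x g) _ _ ⟩
    Σ< x g + (Σ< y (λ n → g (x + n)) + g (x + y))       ∎
    where open ≡-Reasoning

  Σ<-≤ : ∀ {x y} g → x ≤ y → Σ< x g ≤ Σ< y g
  Σ<-≤ {x} {y} g x≤y = subst (λ z → Σ< x g ≤ Σ< z g) (m+[n∸m]≡n x≤y)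
    (subst (Σ< x g ≤_) (sym (Σ<-split x (y ∸ x) g)) (m≤m+n _ _))

  Σ<-blocks : ∀ b a g → Σ< (b * a) g ≡ Σ< b (λ t → Σ< a (λ r → g (t * a + r)))
  Σ<-blocks zero    a g = refl
  Σ<-blocks (suc b) a g = begin
    Σ< (a + b * a) g                                             ≡⟨ cong (λ z → Σ< z g) (+-comm a (b * a)) ⟩
    Σ< (b * a + a) g                                             ≡⟨ Σ<-split (b * a) a g ⟩
    Σ< (b * a) g + Σ< a (λ r → g (b * a + r))                    ≡⟨ cong (_+ Σ< a (λ r → g (b * a + r))) (Σ<-blocks b a g) ⟩
    Σ< b (λ t → Σ< a (λ r → g (t * a + r))) + Σ< a (λ r → g (b * a + r)) ∎
    where open ≡-Reasoning

  Σ<-vanish : ∀ {x y} g → x ≤ y → (∀ n → x ≤ n → g n ≡ 0) → Σ< y g ≡ Σ< x g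
  Σ<-vanish {x} {y} g x≤y v = begin
    Σ< y g                                  ≡⟨ cong (λ z → Σ< z g) (sym (m+[n∸m]≡n x≤y)) ⟩
    Σ< (x + (y ∸ x)) g                      ≡⟨ Σ<-split x (y ∸ x) g ⟩
    Σ< x g + Σ< (y ∸ x) (λ n → g (x + n))   ≡⟨ cong (Σ< x g +_) (Σ<-cong (y ∸ x) λ n _ → v (x + n) (m≤m+n x n)) ⟩
    Σ< x g + Σ< (y ∸ x) (λ _ → 0)           ≡⟨ cong (Σ< x g +_) (trans (Σ<-const (y ∸ x) 0) (*-zeroʳ (y ∸ x))) ⟩
    Σ< x g + 0                              ≡⟨ +-identityʳ _ ⟩
    Σ< x g                                  ∎
    where open ≡-Reasoning

  #-bound : ∀ A x → # A x ≤ x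
  #-bound A x = ≤-trans (Σ<-mono x λ n _ → 𝕀≤1 (A n)) (≤-reflexive (trans (Σ<-const x 1) (*-identityʳ x)))

  Σ<-single : ∀ x g {k} → k < x → g k ≤ Σ< x g
  Σ<-single (suc x) g {k} k<1+x with m≤n⇒m<n∨m≡n (s≤s⁻¹ k<1+x)
  ... | inj₁ k<x  = ≤-trans (Σ<-single x g k<x) (m≤m+n _ _)
  ... | inj₂ refl = m≤n+m (g x) _

  #-none : ∀ x A → (∀ n → n < x → A n ≡ false) → # A x ≡ 0
  #-none x A none = trans (Σ<-cong x λ n n<x → cong 𝕀 (none n n<x)) (trans (Σ<-const x 0) (*-zeroʳ x))

  #-unique : ∀ x A k → (∀ n → n < x → A n ≡ true → n ≡ k) → # A x ≤ 𝕀 (A k)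
  #-unique zero    A k uniq = z≤n
  #-unique (suc x) A k uniq with A x in eq
  ... | false = subst (_≤ 𝕀 (A k)) (sym (+-identityʳ _)) (#-unique x A k λ n n<x → uniq n (m<n⇒m<1+n n<x))
  ... | true with refl ← uniq x ≤-refl eq rewrite eq = ≤-reflexive (cong (_+ 1) (#-none x A λ n n<x → other n n<x))
    where
    other : ∀ n → n < x → A n ≡ false
    other n n<x with A n in eqn
    ... | false = refl
    ... | true  = contradiction (uniq n (m<n⇒m<1+n n<x) eqn) (<⇒≢ n<x)

  #-periodic : ∀ A M → (∀ k n → A (n + k * M) ≡ A n) → ∀ b → # A (b * M) ≡ b * # A M
  #-periodic A M per b = begin
    # A (b * M)                                  ≡⟨ Σ<-blocks b M _ ⟩
    Σ< b (λ t → Σ< M (λ r → 𝕀 (A (t * M + r))))  ≡⟨ Σ<-cong b (λ t _ → Σ<-cong M λ r _ →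
                                                      cong 𝕀 (trans (cong A (+-comm (t * M) r)) (per t r))) ⟩
    Σ< b (λ t → # A M)                           ≡⟨ Σ<-const b _ ⟩
    b * # A M                                    ∎
    where open ≡-Reasoning

  -- Division with the junk value 0 when the divisor is 0, so that divisors need not be literally nonzero.
  infixl 7 _÷_ _mod_

  _÷_ : ℕ → ℕ → ℕ
  n ÷ zero      = 0
  n ÷ a@(suc _) = n / a

  _mod_ : ℕ → ℕ → ℕ
  n mod zero      = 0
  n mod a@(suc _) = n % a

  divMod : ∀ {a} n → 0 < a → n ≡ n ÷ a * a + n mod a
  divMod {suc a} n _ = trans (m≡m%n+[m/n]*n n (suc a)) (+-comm (n % suc a) _)

  mod-< : ∀ {a} n → 0 < a → n mod a < a
  mod-< {suc a} n _ = m%n<n n (suc a)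

  -- The left side lies below (t + 1) a and the right side is at least t′ a, so only one remainder
  -- has to be small. `÷-unique` uses this once in each direction.
  quotient-unique : ∀ {a} t t′ {r r′} → r < a → t * a + r ≡ t′ * a + r′ → t′ ≤ t
  quotient-unique {a} t t′ {r} {r′} r<a eq = ≮⇒≥ λ t<t′ → <-irrefl eq (begin-strict
    t * a + r        <⟨ +-monoʳ-< (t * a) r<a ⟩
    t * a + a        ≡⟨ +-comm (t * a) a ⟩
    suc t * a        ≤⟨ *-monoˡ-≤ a t<t′ ⟩
    t′ * a           ≤⟨ m≤m+n _ r′ ⟩
    t′ * a + r′      ∎)
    where open ≤-Reasoning

  ÷-unique : ∀ {a n} t {r} → r < a → n ≡ t * a + r → n ÷ a ≡ t
  ÷-unique {a} {n} t {r} r<a eq = ≤-antisym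
    (quotient-unique t (n ÷ a) r<a (trans (sym eq) (divMod n 0<a)))
    (quotient-unique (n ÷ a) t (mod-< n 0<a) (trans (sym (divMod n 0<a)) eq))
    where 0<a = ≤-<-trans z≤n r<a

  mod-unique : ∀ {a n} t {r} → r < a → n ≡ t * a + r → n mod a ≡ r
  mod-unique {a} {n} t {r} r<a eq = +-cancelˡ-≡ (t * a) _ _ (begin
    t * a + n mod a       ≡⟨ cong (λ z → z * a + n mod a) (÷-unique t r<a eq) ⟨
    n ÷ a * a + n mod a   ≡⟨ divMod n (≤-<-trans z≤n r<a) ⟨
    n                     ≡⟨ eq ⟩
    t * a + r             ∎)
    where open ≡-Reasoning

  ÷-+ : ∀ {a} n b → 0 < a → (n + b * a) ÷ a ≡ n ÷ a + b
  ÷-+ {a} n b 0<a = ÷-unique (n ÷ a + b) (mod-< n 0<a)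
    (trans (cong (_+ b * a) (divMod n 0<a)) (lemma (n ÷ a) a (n mod a) b))
    where
    lemma : ∀ t a r b → t * a + r + b * a ≡ (t + b) * a + r
    lemma = solve-∀

  mod-+ : ∀ {a} n b → 0 < a → (n + b * a) mod a ≡ n mod a
  mod-+ {a} n b 0<a = mod-unique (n ÷ a + b) (mod-< n 0<a)
    (trans (cong (_+ b * a) (divMod n 0<a)) (lemma (n ÷ a) a (n mod a) b))
    where
    lemma : ∀ t a r b → t * a + r + b * a ≡ (t + b) * a + r
    lemma = solve-∀

  ÷-cancelˡ : ∀ p n a → 0 < p → (p * n) ÷ (p * a) ≡ n ÷ a
  ÷-cancelˡ p n zero 0<p = cong (p * n ÷_) (*-zeroʳ p)
  ÷-cancelˡ p@(suc _) n a@(suc _) 0<p = ÷-unique (n ÷ a) (*-monoʳ-< p (mod-< n z<s))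
    (trans (cong (p *_) (divMod {a} n z<s)) (lemma p (n ÷ a) a (n mod a)))
    where
    lemma : ∀ p t a r → p * (t * a + r) ≡ t * (p * a) + p * r
    lemma = solve-∀

  -- A quotient by a multiple of `M` does not see the residue modulo `M`. This is the source of the
  -- independence of scales: new marks depend on `t` alone, older approximants on `r` alone.
  ÷-block : ∀ a M t {r} → r < M → (t * M + r) ÷ (a * M) ≡ t ÷ a
  ÷-block zero    M t r<M = refl
  ÷-block a@(suc _) M t {r} r<M = ÷-unique (t ÷ a) small
    (trans (cong (λ z → z * M + r) (divMod {a} t z<s)) (lemma (t ÷ a) a (t mod a) M r))
    where
    lemma : ∀ q a s M r → (q * a + s) * M + r ≡ q * (a * M) + (s * M + r)
    lemma = solve-∀
    open ≤-Reasoning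
    small : t mod a * M + r < a * M
    small = begin-strict
      t mod a * M + r    <⟨ +-monoʳ-< (t mod a * M) r<M ⟩
      t mod a * M + M    ≡⟨ +-comm (t mod a * M) M ⟩
      suc (t mod a) * M  ≤⟨ *-monoˡ-≤ M (mod-< {a} t z<s) ⟩
      a * M              ∎

  digit-+ : ∀ {a B} n b → 0 < a → 0 < B → (n + b * (B * a)) ÷ a mod B ≡ n ÷ a mod B
  digit-+ {a} {B} n b 0<a 0<B = begin
    (n + b * (B * a)) ÷ a mod B    ≡⟨ cong (λ z → (n + z) ÷ a mod B) (*-assoc b B a) ⟨
    (n + b * B * a) ÷ a mod B      ≡⟨ cong (_mod B) (÷-+ n (b * B) 0<a) ⟩
    (n ÷ a + b * B) mod B          ≡⟨ mod-+ (n ÷ a) b 0<B ⟩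
    n ÷ a mod B                    ∎
    where open ≡-Reasoning

  #-digit : ∀ {a B c} b → 0 < a → c < B → # (λ n → does (n ÷ a mod B ≟ c)) (b * (B * a)) ≡ b * a
  #-digit {a} {B} {c} b 0<a c<B = begin
    # A (b * (B * a))                             ≡⟨ #-periodic A (B * a) per b ⟩
    b * # A (B * a)                               ≡⟨ cong (b *_) one ⟩
    b * a                                         ∎
    where
    open ≡-Reasoning
    A : ℕ → Bool
    A n = does (n ÷ a mod B ≟ c)
    per : ∀ k n → A (n + k * (B * a)) ≡ A n
    per k n = cong (λ z → does (z ≟ c)) (digit-+ n k 0<a (≤-<-trans z≤n c<B))
    -- Within one period `B * a` the digit equals `t` on the run number `t` of `a` consecutive
    -- integers, so each digit value is taken exactly `a` times.
    digit : ∀ t r → t < B → r < a → 𝕀 (A (t * a + r)) ≡ 𝕀 (does (t ≟ c))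
    digit t r t<B r<a = cong (λ z → 𝕀 (does (z ≟ c)))
      (trans (cong (_mod B) (÷-unique t r<a refl)) (mod-unique 0 t<B refl))
    count : # (λ t → does (t ≟ c)) B ≡ 1
    count = ≤-antisym (≤-trans (#-unique B _ c λ n _ → does-true (n ≟ c)) (𝕀≤1 _))
      (subst (_≤ # (λ t → does (t ≟ c)) B) (cong 𝕀 (dec-true (c ≟ c) refl)) (Σ<-single B (λ t → 𝕀 (does (t ≟ c))) c<B))
    one : # A (B * a) ≡ a
    one = begin
      # A (B * a)                                          ≡⟨ Σ<-blocks B a _ ⟩
      Σ< B (λ t → Σ< a (λ r → 𝕀 (A (t * a + r))))          ≡⟨ Σ<-cong B (λ t t<B → trans
                                                                (Σ<-cong a λ r r<a → digit t r t<B r<a)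
                                                                (trans (Σ<-const a _) (*-comm a _))) ⟩
      Σ< B (λ t → 𝕀 (does (t ≟ c)) * a)                    ≡⟨ Σ<-*ʳ B a _ ⟩
      # (λ t → does (t ≟ c)) B * a                         ≡⟨ cong (_* a) count ⟩
      1 * a                                                ≡⟨ *-identityˡ a ⟩
      a                                                    ∎

  -- Divisor counts of the exponent box

  does-⇔ : ∀ {a b} {A : Set a} {B : Set b} (d : Dec A) (e : Dec B) → (A → B) → (B → A) → does d ≡ does e
  does-⇔ (yes a) e f g = sym (dec-true e (f a))
  does-⇔ (no ¬a) e f g = sym (dec-false e λ b → ¬a (g b))

  𝕀-∧ : ∀ a b → 𝕀 (a ∧ b) ≡ 𝕀 a * 𝕀 b
  𝕀-∧ true  b = sym (+-identityʳ (𝕀 b))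
  𝕀-∧ false b = refl

  𝕀-split : ∀ a b → 𝕀 a ≡ 𝕀 (a ∧ b) + 𝕀 (a ∧ not b)
  𝕀-split true  true  = refl
  𝕀-split true  false = refl
  𝕀-split false b     = refl

  ∧-trueˡ : ∀ a {b} → a ∧ b ≡ true → a ≡ true
  ∧-trueˡ true _ = refl

  ∧-trueʳ : ∀ a {b} → a ∧ b ≡ true → b ≡ true
  ∧-trueʳ true eq = eq

  #-split : ∀ (A C : ℕ → Bool) x → # A x ≡ # (λ n → A n ∧ C n) x + # (λ n → A n ∧ not (C n)) x
  #-split A C x = trans (Σ<-cong x λ n _ → 𝕀-split (A n) (C n)) (Σ<-+ x _ _)

  #-multiples : ∀ (A : ℕ → Bool) {p} b → 0 < p → # (λ q → A q ∧ does (p ∣? q)) (b * p) ≡ # (λ t → A (t * p)) b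
  #-multiples A {p} b 0<p = trans (Σ<-blocks b p _) (Σ<-cong b λ t _ → block t)
    where
    C : ℕ → ℕ → Bool
    C t r = A (t * p + r) ∧ does (p ∣? (t * p + r))
    -- A block of length `p` starts at a multiple of `p` and contains no other one.
    only0 : ∀ t r → r < p → C t r ≡ true → r ≡ 0
    only0 t zero    r<p eq = refl
    only0 t (suc r) r<p eq = contradiction r<p (≤⇒≯ (∣⇒≤ (∣m+n∣m⇒∣n
      (does-true (p ∣? (t * p + suc r)) (∧-trueʳ (A (t * p + suc r)) eq)) (divides t refl))))
    C0 : ∀ t → C t 0 ≡ A (t * p)
    C0 t rewrite +-identityʳ (t * p) | dec-true (p ∣? (t * p)) (divides t refl) with A (t * p)
    ... | true  = refl
    ... | false = refl
    cut : ∀ t r → r < p → 𝕀 (C t r) ≡ 𝕀 (does (r ≟ 0) ∧ A (t * p))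
    cut t zero r<p = cong 𝕀 (C0 t)
    cut t (suc r) r<p with C t (suc r) in eq
    ... | false = refl
    ... | true with () ← only0 t (suc r) r<p eq
    block : ∀ t → # (C t) p ≡ 𝕀 (A (t * p))
    block t = begin
      # (C t) p                                    ≡⟨ Σ<-cong p (cut t) ⟩
      # (λ r → does (r ≟ 0) ∧ A (t * p)) p         ≡⟨ ≤-antisym
        (#-unique p _ 0 λ r _ eq → does-true (r ≟ 0) (∧-trueˡ (does (r ≟ 0)) eq))
        (Σ<-single p (λ r → 𝕀 (does (r ≟ 0) ∧ A (t * p))) 0<p) ⟩
      𝕀 (A (t * p))                                ∎
      where open ≡-Reasoning

  infix 4 _∣ᵇ_
  _∣ᵇ_ : ℕ → ℕ → Bool
  m ∣ᵇ n = does (m ∣? n)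

  divisors : ℕ → ℕ
  divisors D = # (_∣ᵇ D) (suc D)

  -- the divisors of D on the two faces of the exponent box that multiplication by p moves
  lowFace highFace : ℕ → ℕ → ℕ
  lowFace  p D = # (λ q → (q ∣ᵇ D) ∧ not (p ∣ᵇ q)) (suc D)
  highFace p D = # (λ q → (q ∣ᵇ D) ∧ not ((q * p) ∣ᵇ D)) (suc D)

  -- Makes divisor counts insensitive to the cut-off, so that the range can be extended to a whole
  -- number of blocks of length `p`.
  ∣ᵇ-large : ∀ {D} q → 0 < D → suc D ≤ q → (q ∣ᵇ D) ≡ false
  ∣ᵇ-large {D} q 0<D D<q = dec-false (q ∣? D) λ q∣D →
    <-irrefl refl (≤-trans D<q (∣⇒≤ {{>-nonZero 0<D}} q∣D))

  #-divisors : ∀ {D} (C : ℕ → Bool) {y} → 0 < D → suc D ≤ y →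
               # (λ q → (q ∣ᵇ D) ∧ C q) y ≡ # (λ q → (q ∣ᵇ D) ∧ C q) (suc D)
  #-divisors {D} C 0<D D<y = Σ<-vanish _ D<y λ q D<q → cong (λ z → 𝕀 (z ∧ C q)) (∣ᵇ-large q 0<D D<q)

  #-divisors₁ : ∀ {D} {y} → 0 < D → suc D ≤ y → # (_∣ᵇ D) y ≡ divisors D
  #-divisors₁ {D} 0<D D<y = Σ<-vanish _ D<y λ q D<q → cong 𝕀 (∣ᵇ-large q 0<D D<q)

  module _ {p : ℕ} (pp : Prime p) where

    private
      instance _ = prime⇒nonZero pp
      0<p : 0 < p
      0<p = >-nonZero⁻¹ p

    private
      0<mp : ∀ {m} → 0 < m → 0 < m * p
      0<mp 0<m = *-mono-≤ 0<m 0<p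
      *-^-suc : ∀ m k → m * p ^ suc k ≡ m * p ^ k * p
      *-^-suc m k = trans (cong (m *_) (*-comm p (p ^ k))) (sym (*-assoc m (p ^ k) p))
      m≤mp : ∀ m → suc m ≤ suc (m * p)
      m≤mp m = s≤s (m≤m*n m p)

    coprime-divisor : ∀ {q m} → ¬ p ∣ q → q ∣ m * p → q ∣ m
    coprime-divisor {q} {m} p∤q (divides k eq) with euclidsLemma k q pp (divides m (sym eq))
    ... | inj₂ p∣q = contradiction p∣q p∤q
    ... | inj₁ (divides l refl) = divides l (*-cancelʳ-≡ m (l * q) p (begin
          m * p      ≡⟨ eq ⟩
          l * p * q  ≡⟨ lemma l p q ⟩
          l * q * p  ∎))
      where
      open ≡-Reasoning
      lemma : ∀ l p q → l * p * q ≡ l * q * p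
      lemma = solve-∀

    -- A further factor `p` creates no new divisor outside the multiples of `p`.
    lowFace-* : ∀ m → 0 < m → lowFace p (m * p) ≡ lowFace p m
    lowFace-* m 0<m = trans (Σ<-cong (suc (m * p)) λ q _ → cong 𝕀 (same q))
                            (#-divisors (λ q → not (p ∣ᵇ q)) 0<m (m≤mp m))
      where
      same : ∀ q → ((q ∣ᵇ m * p) ∧ not (p ∣ᵇ q)) ≡ ((q ∣ᵇ m) ∧ not (p ∣ᵇ q))
      same q with p ∣? q
      ... | yes _  = trans (∧-zeroʳ (q ∣ᵇ m * p)) (sym (∧-zeroʳ (q ∣ᵇ m)))
      ... | no p∤q = cong (_∧ true) (does-⇔ (q ∣? (m * p)) (q ∣? m) (coprime-divisor p∤q) (∣m⇒∣m*n p))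

    -- A divisor of `m * p` is either `p` times a divisor of `m` or not divisible by `p`.
    divisors-* : ∀ m → 0 < m → divisors (m * p) ≡ divisors m + lowFace p m
    divisors-* m 0<m = begin
      divisors (m * p)                                        ≡⟨ #-divisors₁ (0<mp 0<m) y≤ ⟨
      # (_∣ᵇ m * p) y                                         ≡⟨ #-split (_∣ᵇ m * p) (p ∣ᵇ_) y ⟩
      # (λ q → (q ∣ᵇ m * p) ∧ (p ∣ᵇ q)) y + # (λ q → (q ∣ᵇ m * p) ∧ not (p ∣ᵇ q)) y
        ≡⟨ cong₂ _+_ (#-multiples (_∣ᵇ m * p) (suc (m * p)) 0<p) (#-divisors (λ q → not (p ∣ᵇ q)) (0<mp 0<m) y≤) ⟩
      # (λ t → (t * p) ∣ᵇ (m * p)) (suc (m * p)) + lowFace p (m * p)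
        ≡⟨ cong₂ _+_ (Σ<-cong (suc (m * p)) λ t _ → cong 𝕀 (does-⇔ ((t * p) ∣? (m * p)) (t ∣? m) (*-cancelʳ-∣ p) (*-monoˡ-∣ p)))
                     (lowFace-* m 0<m) ⟩
      # (_∣ᵇ m) (suc (m * p)) + lowFace p m                   ≡⟨ cong (_+ lowFace p m) (#-divisors₁ 0<m (m≤mp m)) ⟩
      divisors m + lowFace p m                                ∎
      where
      open ≡-Reasoning
      y = suc (m * p) * p
      y≤ : suc (m * p) ≤ y
      y≤ = m≤m*n (suc (m * p)) p

    -- Both faces have d(mp) - d(m) elements, because `q * p` divides `m * p` exactly when `q`
    -- divides `m`.
    highFace≡lowFace : ∀ m → 0 < m → highFace p (m * p) ≡ lowFace p (m * p)
    highFace≡lowFace m 0<m = +-cancelˡ-≡ (divisors m) _ _ (begin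
      divisors m + highFace p (m * p)
        ≡⟨ cong (_+ highFace p (m * p)) (#-divisors₁ 0<m (m≤mp m)) ⟨
      # (_∣ᵇ m) (suc (m * p)) + highFace p (m * p)
        ≡⟨ cong (_+ highFace p (m * p)) (Σ<-cong (suc (m * p)) λ q _ → cong 𝕀 (same q)) ⟨
      # (λ q → (q ∣ᵇ m * p) ∧ ((q * p) ∣ᵇ (m * p))) (suc (m * p)) + highFace p (m * p)
        ≡⟨ #-split (_∣ᵇ m * p) (λ q → (q * p) ∣ᵇ (m * p)) (suc (m * p)) ⟨
      divisors (m * p)              ≡⟨ divisors-* m 0<m ⟩
      divisors m + lowFace p m      ≡⟨ cong (divisors m +_) (lowFace-* m 0<m) ⟨
      divisors m + lowFace p (m * p) ∎)
      where
      open ≡-Reasoning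
      same : ∀ q → ((q ∣ᵇ m * p) ∧ ((q * p) ∣ᵇ (m * p))) ≡ (q ∣ᵇ m)
      same q with q ∣? m
      ... | yes q∣m rewrite dec-true (q ∣? (m * p)) (∣m⇒∣m*n p q∣m)
                          | dec-true ((q * p) ∣? (m * p)) (*-monoˡ-∣ p q∣m) = refl
      ... | no q∤m rewrite dec-false ((q * p) ∣? (m * p)) (λ z → q∤m (*-cancelʳ-∣ p z)) with q ∣ᵇ m * p
      ...   | true  = refl
      ...   | false = refl

    -- Each factor `p` adds to the box one more layer of the constant size `lowFace p m`, so after
    -- `k` factors the box holds at least `k` layers.
    lowFace-small : ∀ k m → 0 < m → 0 < m * p ^ k × k * lowFace p (m * p ^ k) ≤ divisors (m * p ^ k)
                                   × lowFace p (m * p ^ k) ≡ lowFace p m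
    lowFace-small zero    m 0<m rewrite *-identityʳ m = 0<m , z≤n , refl
    lowFace-small (suc k) m 0<m with lowFace-small k m 0<m
    ... | 0<n , le , eq rewrite *-^-suc m k =
      0<mp 0<n , step , trans (lowFace-* _ 0<n) eq
      where
      open ≤-Reasoning
      n = m * p ^ k
      step : suc k * lowFace p (n * p) ≤ divisors (n * p)
      step = begin
        suc k * lowFace p (n * p)           ≡⟨ cong (suc k *_) (lowFace-* n 0<n) ⟩
        lowFace p n + k * lowFace p n       ≤⟨ +-monoʳ-≤ (lowFace p n) le ⟩
        lowFace p n + divisors n            ≡⟨ +-comm (lowFace p n) _ ⟩
        divisors n + lowFace p n            ≡⟨ divisors-* n 0<n ⟨
        divisors (n * p)                    ∎

    -- The two faces have equal size and each is at most a (j+1)-th of the box; the factor 2 counts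
    -- them both. This is the Følner property of the box.
    faces-small : ∀ j {D} → 0 < D → p ^ suc j ∣ D →
                  suc j * (highFace p D + lowFace p D) ≤ 2 * divisors D
    faces-small j {D} 0<D (divides m refl) = begin
      suc j * (highFace p D + lowFace p D)   ≡⟨ cong (λ z → suc j * (z + lowFace p D)) high ⟩
      suc j * (lowFace p D + lowFace p D)    ≡⟨ lemma (suc j) (lowFace p D) ⟩
      2 * (suc j * lowFace p D)              ≤⟨ *-monoʳ-≤ 2 (proj₁ (proj₂ (lowFace-small (suc j) m 0<m))) ⟩
      2 * divisors D                         ∎
      where
      open ≤-Reasoning
      lemma : ∀ k f → k * (f + f) ≡ 2 * (k * f)
      lemma = solve-∀
      0<m : 0 < m
      0<m = n≢0⇒n>0 λ m≡0 → <-irrefl (sym (cong (_* p ^ suc j) m≡0)) 0<D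
      split : m * p ^ suc j ≡ m * p ^ j * p
      split = *-^-suc m j
      high : highFace p D ≡ lowFace p D
      high = subst (λ z → highFace p z ≡ lowFace p z) (sym split)
        (highFace≡lowFace (m * p ^ j) (proj₁ (lowFace-small j m 0<m)))

  divisors≥1 : ∀ {D} → 0 < D → 1 ≤ divisors D
  divisors≥1 {D} 0<D = subst (_≤ divisors D) (cong 𝕀 (dec-true (1 ∣? D) (1∣ D))) (Σ<-single (suc D) (λ q → 𝕀 (q ∣ᵇ D)) (s≤s 0<D))

  -- Marking

  infix 4 _≟ᴹ_
  _≟ᴹ_ : (x y : Maybe Sign) → Dec (x ≡ y)
  _≟ᴹ_ = Maybe.≡-dec Sign._≟_

  agree : ∀ {x y : Maybe Sign} {k} → x ≡ y → 𝕀 (not (does (x ≟ᴹ y))) ≤ k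
  agree {x} {y} eq rewrite dec-true (x ≟ᴹ y) eq = z≤n

  -- The sets digit q, for q ∣ D, are pairwise disjoint dilates of one periodic set of density 1/B.
  module Mark (ψ : ℕ → Sign) (D B : ℕ) where

    module At (P : ℕ) where

      digit : ℕ → ℕ → Bool
      digit q n = does (n ÷ (q * P) mod B ≟ D)

      hit : ℕ → ℕ → Bool
      hit q n = (q ∣ᵇ D) ∧ digit q n

      -- The only label that can hit `n`, read off from the digit at scale `P` (see
      -- `hit⇒candidate`), so that `marked` has a single label to test.
      candidate : ℕ → ℕ
      candidate n = n ÷ P mod B ÷ D

      marked : ℕ → Bool
      marked n = hit (candidate n) n

      mark : ℕ → Maybe Sign
      mark n = if marked n then just (ψ (candidate n)) else nothing

      -- Comparing in `Maybe Sign` also counts the `n` for which just one of `n` and `φ n` is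
      -- marked: overriding only one of the two values could break an equation that held before.
      gap : (ℕ → ℕ) → Sign → ℕ → Bool
      gap φ w n = not (does (mark (φ n) ≟ᴹ Maybe.map (w Sign.*_) (mark n)))

    open At

    unmarked⇒nothing : ∀ P n → marked P n ≡ false → mark P n ≡ nothing
    unmarked⇒nothing P n = cong (λ b → if b then just (ψ (candidate P n)) else nothing)

    module _ (P M t : ℕ) {r : ℕ} (r<M : r < M) where

      candidate-block : candidate (P * M) (t * M + r) ≡ candidate P t
      candidate-block = cong (λ z → z mod B ÷ D) (÷-block P M t r<M)

      marked-block : marked (P * M) (t * M + r) ≡ marked P t
      marked-block =
        cong₂ _∧_ (cong (_∣ᵇ D) candidate-block) (cong (λ z → does (z mod B ≟ D)) (trans
          (cong (λ q → (t * M + r) ÷ (q * (P * M))) candidate-block)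
          (trans (cong ((t * M + r) ÷_) (sym (*-assoc (candidate P t) P M))) (÷-block (candidate P t * P) M t r<M))))

      mark-block : mark (P * M) (t * M + r) ≡ mark P t
      mark-block = cong₂ (λ b c → if b then just (ψ c) else nothing) marked-block candidate-block

    module _ (0<D : 0 < D) (room : D * D + D ≤ B) {P : ℕ} (0<P : 0 < P) where

      period : ℕ
      period = D * (B * P)

      private
        D<B : D < B
        D<B = ≤-trans (≤-trans (≤-reflexive (sym (+-comm D 1))) (≤-trans (+-monoʳ-≤ D (*-mono-≤ 0<D 0<D))
                (≤-reflexive (+-comm D (D * D))))) room

        0<B : 0 < B
        0<B = <-trans 0<D D<B

      ∣D⇒0< : ∀ {q} → q ∣ D → 0 < q
      ∣D⇒0< {zero}  (divides k eq) = contradiction (trans eq (*-zeroʳ k)) λ { refl → <-irrefl refl 0<D }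
      ∣D⇒0< {suc q} _              = z<s

      0<qP : ∀ {q} → q ∣ D → 0 < q * P
      0<qP q∣D = *-mono-≤ (∣D⇒0< q∣D) 0<P

      -- If ⌊n/qP⌋ = uB + D, then ⌊n/P⌋ = quB + qD + r with r < q ≤ D, which reveals q.
      hit⇒candidate : ∀ q n → hit P q n ≡ true → candidate P n ≡ q
      hit⇒candidate q n h = begin
        n ÷ P mod B ÷ D            ≡⟨ cong (λ z → z mod B ÷ D) (÷-unique (v * q + r) {s} s<P eq) ⟩
        (v * q + r) mod B ÷ D      ≡⟨ cong (_÷ D) (mod-unique (u * q) small eq′) ⟩
        (q * D + r) ÷ D            ≡⟨ ÷-unique q r<D refl ⟩
        q                          ∎
        where
        open ≡-Reasoning
        q∣D = does-true (q ∣? D) (∧-trueˡ (q ∣ᵇ D) h)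
        v = n ÷ (q * P)
        u = v ÷ B
        R = n mod (q * P)
        r = R ÷ P
        s = R mod P
        s<P = mod-< R 0<P
        v≡ : v ≡ u * B + D
        v≡ = trans (divMod v 0<B) (cong (u * B +_) (does-true (v mod B ≟ D) (∧-trueʳ (q ∣ᵇ D) h)))
        lemma : ∀ v q P r s → v * (q * P) + (r * P + s) ≡ (v * q + r) * P + s
        lemma = solve-∀
        eq : n ≡ (v * q + r) * P + s
        eq = trans (divMod n (0<qP q∣D)) (trans (cong (v * (q * P) +_) (divMod R 0<P)) (lemma v q P r s))
        lemma′ : ∀ u B D q r → (u * B + D) * q + r ≡ u * q * B + (q * D + r)
        lemma′ = solve-∀
        eq′ : v * q + r ≡ u * q * B + (q * D + r)
        eq′ = trans (cong (λ z → z * q + r) v≡) (lemma′ u B D q r)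
        r<q : r < q
        r<q = *-cancelʳ-< P r q (≤-<-trans (≤-trans (m≤m+n (r * P) s) (≤-reflexive (sym (divMod R 0<P))))
                                           (mod-< n (0<qP q∣D)))
        q≤D : q ≤ D
        q≤D = ∣⇒≤ {{>-nonZero 0<D}} q∣D
        r<D : r < D
        r<D = <-≤-trans r<q q≤D
        -- No carry occurs: `q * D + r` is a single digit in base `B`. This is what `room` is for.
        small : q * D + r < B
        small = <-≤-trans (+-mono-≤-< (*-monoˡ-≤ D q≤D) r<D) room

      hit⇒marked : ∀ q n → hit P q n ≡ true → marked P n ≡ true
      hit⇒marked q n h = trans (cong (λ z → hit P z n) (hit⇒candidate q n h)) h

      hit⇒mark : ∀ q n → hit P q n ≡ true → mark P n ≡ just (ψ q)
      hit⇒mark q n h rewrite hit⇒marked q n h = cong (λ z → just (ψ z)) (hit⇒candidate q n h)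

      -- By disjointness at most one label hits `n`, so the indicator is a sum over labels and can
      -- be counted one label at a time.
      𝕀-marked : ∀ n → 𝕀 (marked P n) ≡ Σ< (suc D) (λ q → 𝕀 (hit P q n))
      𝕀-marked n = ≤-antisym lower (#-unique (suc D) _ (candidate P n) λ q _ h → sym (hit⇒candidate q n h))
        where
        lower : 𝕀 (marked P n) ≤ Σ< (suc D) (λ q → 𝕀 (hit P q n))
        lower with marked P n in eq
        ... | false = z≤n
        ... | true  = subst (_≤ Σ< (suc D) (λ q → 𝕀 (hit P q n))) (cong 𝕀 eq)
          (Σ<-single (suc D) (λ q → 𝕀 (hit P q n)) (s≤s (∣⇒≤ {{>-nonZero 0<D}}
            (does-true (candidate P n ∣? D) (∧-trueˡ (candidate P n ∣ᵇ D) eq)))))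

      #-digit-period : ∀ {q} → q ∣ D → # (digit P q) period ≡ D * P
      #-digit-period {q} (divides e refl) = begin
        # (digit P q) (e * q * (B * P))       ≡⟨ cong (# (digit P q)) (lemma e q B P) ⟩
        # (digit P q) (e * (B * (q * P)))     ≡⟨ #-digit e (0<qP (divides e refl)) D<B ⟩
        e * (q * P)                           ≡⟨ *-assoc e q P ⟨
        e * q * P                             ∎
        where
        open ≡-Reasoning
        lemma : ∀ e q B P → e * q * (B * P) ≡ e * (B * (q * P))
        lemma = solve-∀

      #-digit-dilated : ∀ {p q} → 0 < p → p ∣ P → q ∣ D → # (λ n → digit P q (p * n)) period ≡ D * P
      #-digit-dilated {p} {q} 0<p (divides k refl) q∣D@(divides e refl) = begin
        # (λ n → digit P q (p * n)) period           ≡⟨ Σ<-cong period (λ n _ → cong (λ z → 𝕀 (does (z mod B ≟ D))) (reduce n)) ⟩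
        # A (e * q * (B * (k * p)))                  ≡⟨ cong (# A) (lemma e q B k p) ⟩
        # A (e * p * (B * (q * k)))                  ≡⟨ #-digit (e * p) 0<qk D<B ⟩
        e * p * (q * k)                              ≡⟨ lemma′ e q k p ⟩
        e * q * (k * p)                              ∎
        where
        open ≡-Reasoning
        A : ℕ → Bool
        A n = does (n ÷ (q * k) mod B ≟ D)
        lemma : ∀ e q B k p → e * q * (B * (k * p)) ≡ e * p * (B * (q * k))
        lemma = solve-∀
        lemma′ : ∀ e q k p → e * p * (q * k) ≡ e * q * (k * p)
        lemma′ = solve-∀
        swap : ∀ q k p → q * (k * p) ≡ p * (q * k)
        swap = solve-∀
        -- As `p` divides `P`, the preimage of a digit set under multiplication by `p` is the digit
        -- set of scale P / p, again of density 1/B.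
        reduce : ∀ n → (p * n) ÷ (q * (k * p)) ≡ n ÷ (q * k)
        reduce n = trans (cong (p * n ÷_) (swap q k p)) (÷-cancelˡ p n (q * k) 0<p)
        0<k : 0 < k
        0<k = n≢0⇒n>0 λ { refl → <-irrefl refl 0<P }
        0<qk : 0 < q * k
        0<qk = *-mono-≤ (∣D⇒0< q∣D) 0<k

      -- After exchanging the sums, every label contributes the same number `D * P` of points per
      -- period, whatever its size. Proportions of integers thereby become proportions of divisors
      -- of `D`.
      Σ-hits : ∀ (C : ℕ → Bool) (E : ℕ → ℕ → Bool) → (∀ q → q ∣ D → # (E q) period ≡ D * P) →
               Σ< period (λ n → # (λ q → ((q ∣ᵇ D) ∧ C q) ∧ E q n) (suc D)) ≡
               # (λ q → (q ∣ᵇ D) ∧ C q) (suc D) * (D * P)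
      Σ-hits C E count = begin
        Σ< period (λ n → # (λ q → ((q ∣ᵇ D) ∧ C q) ∧ E q n) (suc D))
          ≡⟨ Σ<-swap period (suc D) _ ⟩
        Σ< (suc D) (λ q → # (λ n → ((q ∣ᵇ D) ∧ C q) ∧ E q n) period)
          ≡⟨ Σ<-cong (suc D) (λ q _ → trans (Σ<-cong period (λ n _ → 𝕀-∧ ((q ∣ᵇ D) ∧ C q) (E q n)))
               (trans (Σ<-*ˡ period (𝕀 ((q ∣ᵇ D) ∧ C q)) _) (one q))) ⟩
        Σ< (suc D) (λ q → 𝕀 ((q ∣ᵇ D) ∧ C q) * (D * P))
          ≡⟨ Σ<-*ʳ (suc D) (D * P) _ ⟩
        # (λ q → (q ∣ᵇ D) ∧ C q) (suc D) * (D * P) ∎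
        where
        open ≡-Reasoning
        one : ∀ q → 𝕀 ((q ∣ᵇ D) ∧ C q) * # (E q) period ≡ 𝕀 ((q ∣ᵇ D) ∧ C q) * (D * P)
        one q with q ∣? D
        ... | yes q∣D = cong (𝕀 (C q) *_) (count q q∣D)
        ... | no _    = refl

      #-marked : # (marked P) period ≡ divisors D * (D * P)
      #-marked = begin
        # (marked P) period                                        ≡⟨ Σ<-cong period (λ n _ → 𝕀-marked n) ⟩
        Σ< period (λ n → # (λ q → hit P q n) (suc D))              ≡⟨ Σ<-cong period (λ n _ → Σ<-cong (suc D) λ q _ →
                                                                        cong (λ z → 𝕀 (z ∧ digit P q n)) (sym (∧-identityʳ (q ∣ᵇ D)))) ⟩
        Σ< period (λ n → # (λ q → ((q ∣ᵇ D) ∧ true) ∧ digit P q n) (suc D))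
          ≡⟨ Σ-hits (λ _ → true) (digit P) (λ q → #-digit-period) ⟩
        # (λ q → (q ∣ᵇ D) ∧ true) (suc D) * (D * P)
          ≡⟨ cong (_* (D * P)) (Σ<-cong (suc D) λ q _ → cong 𝕀 (∧-identityʳ (q ∣ᵇ D))) ⟩
        divisors D * (D * P)                                       ∎
        where
        open ≡-Reasoning

      mark-+ : ∀ k n → mark P (n + k * period) ≡ mark P n
      mark-+ k n = cong₂ (λ b c → if b then just (ψ c) else nothing)
                         (trans (cong (λ z → hit P z (n + k * period)) cand) (hit-+ (candidate P n)))
                         cand
        where
        lemma : ∀ k D B P → k * (D * (B * P)) ≡ k * D * (B * P)
        lemma = solve-∀
        cand : candidate P (n + k * period) ≡ candidate P n
        cand = cong (_÷ D) (trans (cong (λ z → (n + z) ÷ P mod B) (lemma k D B P)) (digit-+ n (k * D) 0<P 0<B))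
        hit-+ : ∀ q → hit P q (n + k * period) ≡ hit P q n
        hit-+ q with q ∣? D
        ... | no _ = refl
        ... | yes q∣D@(divides e D≡eq) = cong (λ z → does (z ≟ D))
            (trans (cong (λ z → (n + z) ÷ (q * P) mod B) (trans (cong (λ z → k * (z * (B * P))) D≡eq) (lemma′ k e q B P)))
                   (digit-+ n (k * e) (0<qP q∣D) 0<B))
          where
          lemma′ : ∀ k e q B P → k * (e * q * (B * P)) ≡ k * e * (B * (q * P))
          lemma′ = solve-∀

      marked-+ : ∀ k n → marked P (n + k * period) ≡ marked P n
      marked-+ k n = trans (is-just-mark (n + k * period)) (trans (cong is-just (mark-+ k n)) (sym (is-just-mark n)))
        where
        is-just-mark : ∀ n → marked P n ≡ is-just (mark P n)
        is-just-mark n with marked P n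
        ... | true  = refl
        ... | false = refl

      #-gap-suc : # (gap P suc Sign.+) period ≤ D * B
      #-gap-suc = begin
        # (gap P suc Sign.+) period                                   ≡⟨ cong (# (gap P suc Sign.+)) (*-assoc D B P) ⟨
        # (gap P suc Sign.+) (D * B * P)                              ≡⟨ Σ<-blocks (D * B) P _ ⟩
        Σ< (D * B) (λ t → # (λ r → gap P suc Sign.+ (t * P + r)) P)   ≤⟨ Σ<-mono (D * B) (λ t _ →
                                                                           ≤-trans (#-unique P _ (pred P) (last t)) (𝕀≤1 _)) ⟩
        Σ< (D * B) (λ _ → 1)                                          ≡⟨ trans (Σ<-const (D * B) 1) (*-identityʳ (D * B)) ⟩
        D * B                                                         ∎
        where
        open ≤-Reasoning
        block : ∀ t r → r < P → mark P (t * P + r) ≡ mark 1 t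
        block t r r<P = subst (λ z → mark z (t * P + r) ≡ mark 1 t) (*-identityˡ P) (mark-block 1 P t r<P)
        map-id : ∀ (x : Maybe Sign) → Maybe.map (Sign.+ Sign.*_) x ≡ x
        map-id (just _) = refl
        map-id nothing  = refl
        -- Marks are constant on blocks of length `P`, hence only the last element of a block can
        -- differ from its successor.
        same : ∀ t r → suc r < P → mark P (suc (t * P + r)) ≡ Maybe.map (Sign.+ Sign.*_) (mark P (t * P + r))
        same t r r+1<P = trans (cong (mark P) (sym (+-suc (t * P) r)))
          (trans (block t (suc r) r+1<P) (trans (sym (block t r (<⇒≤ r+1<P))) (sym (map-id _))))
        last : ∀ t r → r < P → gap P suc Sign.+ (t * P + r) ≡ true → r ≡ pred P
        last t r r<P g with m≤n⇒m<n∨m≡n r<P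
        ... | inj₂ refl = refl
        ... | inj₁ r+1<P with () ← trans (sym g) (cong not (dec-true (_ ≟ᴹ _) (same t r r+1<P)))

      module _ {p : ℕ} (pp : Prime p) (p∣P : p ∣ P) (ψ-* : ∀ q → 0 < q → ψ (p * q) ≡ ψ p Sign.* ψ q) where

        private
          0<p : 0 < p
          0<p = >-nonZero⁻¹ p {{prime⇒nonZero pp}}

        hit-dilate : ∀ q n → hit P q n ≡ true → q * p ∣ D → hit P (q * p) (p * n) ≡ true
        hit-dilate q n h qp∣D rewrite dec-true ((q * p) ∣? D) qp∣D =
          trans (cong (λ z → does (z mod B ≟ D)) (trans (cong (p * n ÷_) (lemma q p P)) (÷-cancelˡ p n (q * P) 0<p)))
                (∧-trueʳ (q ∣ᵇ D) h)
          where
          lemma : ∀ q p P → q * p * P ≡ p * (q * P)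
          lemma = solve-∀

        hit-undilate : ∀ q n → hit P (q * p) (p * n) ≡ true → hit P q n ≡ true
        hit-undilate q n h rewrite dec-true (q ∣? D) (∣-trans (divides p (*-comm q p)) (does-true ((q * p) ∣? D) (∧-trueˡ ((q * p) ∣ᵇ D) h))) =
          trans (cong (λ z → does (z mod B ≟ D)) (sym (trans (cong (p * n ÷_) (lemma q p P)) (÷-cancelˡ p n (q * P) 0<p))))
                (∧-trueʳ ((q * p) ∣ᵇ D) h)
          where
          lemma : ∀ q p P → q * p * P ≡ p * (q * P)
          lemma = solve-∀

        private
          high low : ℕ → ℕ → Bool
          high n q = ((q ∣ᵇ D) ∧ not ((q * p) ∣ᵇ D)) ∧ digit P q n
          low  n q = ((q ∣ᵇ D) ∧ not (p ∣ᵇ q)) ∧ digit P q (p * n)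

        -- If the label `q` of `n` satisfies `q * p ∣ D`, then `p * n` carries the label `q * p` and
        -- the signs match because `ψ` is multiplicative; otherwise `q` lies on the high face. If
        -- `n` is unmarked, the label of a marked `p * n` cannot be divisible by `p`, since the
        -- quotient would mark `n`; so it lies on the low face.
        gap⇒face : ∀ n → 𝕀 (gap P (p *_) (ψ p) n) ≤ # (high n) (suc D) + # (low n) (suc D)
        gap⇒face n with marked P n in eqn
        ... | true  with (candidate P n * p) ∣? D
        ...   | yes qp∣D = agree (trans (hit⇒mark (q * p) (p * n) (hit-dilate q n eqn qp∣D))
                                        (cong just (trans (cong ψ (*-comm q p)) (ψ-* q (∣D⇒0< q∣D)))))
          where
          q = candidate P n
          q∣D = does-true (q ∣? D) (∧-trueˡ (q ∣ᵇ D) eqn)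
        ...   | no qp∤D = ≤-trans (𝕀≤1 _) (≤-trans (≤-trans (≤-reflexive (sym (cong 𝕀 q-high)))
                            (Σ<-single (suc D) (λ q → 𝕀 (high n q)) q<)) (m≤m+n _ _))
          where
          q∣D = does-true (candidate P n ∣? D) (∧-trueˡ (candidate P n ∣ᵇ D) eqn)
          q< : candidate P n < suc D
          q< = s≤s (∣⇒≤ {{>-nonZero 0<D}} q∣D)
          q-high : high n (candidate P n) ≡ true
          q-high rewrite dec-true (candidate P n ∣? D) q∣D | dec-false ((candidate P n * p) ∣? D) qp∤D = ∧-trueʳ (candidate P n ∣ᵇ D) eqn
        gap⇒face n | false with marked P (p * n) in eqpn
        ... | false = z≤n
        ... | true with p ∣? candidate P (p * n)
        ...   | yes (divides q c≡) with () ← trans (sym eqn) (hit⇒marked q n (hit-undilate q n (trans (cong (λ z → hit P z (p * n)) (sym c≡)) eqpn)))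
        ...   | no p∤c = ≤-trans (≤-trans (≤-reflexive (sym (cong 𝕀 c-low)))
                           (Σ<-single (suc D) (λ q → 𝕀 (low n q)) c<)) (m≤n+m (# (low n) (suc D)) (# (high n) (suc D)))
          where
          c = candidate P (p * n)
          c∣D = does-true (c ∣? D) (∧-trueˡ (c ∣ᵇ D) eqpn)
          c< : c < suc D
          c< = s≤s (∣⇒≤ {{>-nonZero 0<D}} c∣D)
          c-low : low n c ≡ true
          c-low rewrite dec-true (c ∣? D) c∣D | dec-false (p ∣? c) p∤c = ∧-trueʳ (c ∣ᵇ D) eqpn

        #-gap : # (gap P (p *_) (ψ p)) period ≤ (highFace p D + lowFace p D) * (D * P)
        #-gap = begin
          # (gap P (p *_) (ψ p)) period                            ≤⟨ Σ<-mono period (λ n _ → gap⇒face n) ⟩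
          Σ< period (λ n → # (high n) (suc D) + # (low n) (suc D)) ≡⟨ Σ<-+ period _ _ ⟩
          Σ< period (λ n → # (high n) (suc D)) + Σ< period (λ n → # (low n) (suc D))
            ≡⟨ cong₂ _+_ (Σ-hits _ (digit P) λ q → #-digit-period)
                         (Σ-hits _ (λ q n → digit P q (p * n)) λ q → #-digit-dilated 0<p p∣P) ⟩
          highFace p D * (D * P) + lowFace p D * (D * P)           ≡⟨ *-distribʳ-+ (D * P) (highFace p D) _ ⟨
          (highFace p D + lowFace p D) * (D * P)                   ∎
          where open ≤-Reasoning

  -- Vanishing densities, levels and gluing

  not-does : ∀ {a} {A : Set a} (d : Dec A) → not (does d) ≡ false → A
  not-does (yes a) _ = a

  ∨-falseˡ : ∀ a {b} → a ∨ b ≡ false → a ≡ false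
  ∨-falseˡ false _ = refl

  ∨-falseʳ : ∀ a {b} → a ∨ b ≡ false → b ≡ false
  ∨-falseʳ false eq = eq

  contrapositive : ∀ a b → (b ≡ false → a ≡ false) → a ≡ true → b ≡ true
  contrapositive a true  f eq = refl
  contrapositive a false f eq with () ← trans (sym eq) (f refl)

  -- e i / d i → 0 as i → ∞
  Vanishing : (ℕ → ℕ) → (ℕ → ℕ) → Set
  Vanishing e d = ∀ m → ∃ λ i₀ → ∀ i → i₀ ≤ i → m * e i ≤ d i

  vanishing-≤ : ∀ {e e′ d} → (∃ λ i₀ → ∀ i → i₀ ≤ i → e i ≤ e′ i) → Vanishing e′ d → Vanishing e d
  vanishing-≤ (i₁ , le) v m with v m
  ... | i₀ , small = i₀ ⊔ i₁ , λ i i≥ → ≤-trans (*-monoʳ-≤ m (le i (≤-trans (m≤n⊔m i₀ i₁) i≥)))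
                                                (small i (≤-trans (m≤m⊔n i₀ i₁) i≥))

  vanishing-+ : ∀ {e e′ d} → Vanishing e d → Vanishing e′ d → Vanishing (λ i → e i + e′ i) d
  vanishing-+ {e} {e′} {d} v v′ m with v (2 * m) | v′ (2 * m)
  ... | i₀ , small | i₁ , small′ = i₀ ⊔ i₁ , λ i i≥ → *-cancelˡ-≤ 2 (begin
        2 * (m * (e i + e′ i))        ≡⟨ lemma m (e i) (e′ i) ⟩
        2 * m * e i + 2 * m * e′ i    ≤⟨ +-mono-≤ (small i (≤-trans (m≤m⊔n i₀ i₁) i≥))
                                                 (small′ i (≤-trans (m≤n⊔m i₀ i₁) i≥)) ⟩
        d i + d i                     ≡⟨ cong (d i +_) (+-identityʳ (d i)) ⟨
        2 * d i                       ∎)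
    where
    open ≤-Reasoning
    lemma : ∀ m a b → 2 * (m * (a + b)) ≡ 2 * m * a + 2 * m * b
    lemma = solve-∀

  -- For increasing X, the largest j ≥ 1 with X j ≤ n, or 0 if there is none.
  level : (ℕ → ℕ) → ℕ → ℕ
  level X zero    = 0
  level X (suc n) = if does (X (suc (level X n)) ≤? suc n) then suc (level X n) else level X n

  if-cases : ∀ {a b} {A : Set a} {B : Set b} (d : Dec A) {x y : B} →
             ((if does d then x else y) ≡ x × A) ⊎ ((if does d then x else y) ≡ y × ¬ A)
  if-cases (yes a) = inj₁ (refl , a)
  if-cases (no ¬a) = inj₂ (refl , ¬a)

  level-step : ∀ X n → (level X (suc n) ≡ suc (level X n) × X (suc (level X n)) ≤ suc n)
                     ⊎ (level X (suc n) ≡ level X n × suc n < X (suc (level X n)))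
  level-step X n with if-cases (X (suc (level X n)) ≤? suc n)
  ... | inj₁ (eq , le)  = inj₁ (eq , le)
  ... | inj₂ (eq , ¬le) = inj₂ (eq , ≰⇒> ¬le)

  level-mono-suc : ∀ X n → level X n ≤ level X (suc n)
  level-mono-suc X n with level-step X n
  ... | inj₁ (eq , _) = ≤-trans (n≤1+n _) (≤-reflexive (sym eq))
  ... | inj₂ (eq , _) = ≤-reflexive (sym eq)

  level-mono : ∀ X {m n} → m ≤ n → level X m ≤ level X n
  level-mono X {m} {n} m≤n = subst (λ z → level X m ≤ level X z) (m+[n∸m]≡n m≤n) (go (n ∸ m))
    where
    go : ∀ k → level X m ≤ level X (m + k)
    go zero    = ≤-reflexive (cong (level X) (sym (+-identityʳ m)))
    go (suc k) = ≤-trans (go k) (≤-trans (level-mono-suc X (m + k)) (≤-reflexive (cong (level X) (sym (+-suc m k)))))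

  -- The maximum with `X 0` covers the default level 0, which is held before any threshold is
  -- reached.
  level-≤ : ∀ X n → X (level X n) ≤ n ⊔ X 0
  level-≤ X zero    = ≤-refl
  level-≤ X (suc n) with level-step X n
  ... | inj₁ (eq , le) = subst (λ z → X z ≤ suc n ⊔ X 0) (sym eq) (≤-trans le (m≤m⊔n (suc n) (X 0)))
  ... | inj₂ (eq , _)  = subst (λ z → X z ≤ suc n ⊔ X 0) (sym eq) (≤-trans (level-≤ X n) (⊔-monoˡ-≤ (X 0) (n≤1+n n)))

  level-unbounded : ∀ X j → ∃ λ n₀ → ∀ n → n₀ ≤ n → j ≤ level X n
  level-unbounded X zero    = 0 , λ _ _ → z≤n
  level-unbounded X (suc j) with level-unbounded X j
  ... | n₀ , reached = suc n₁ , λ n n>n₁ → ≤-trans now (level-mono X n>n₁)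
    where
    n₁ = n₀ ⊔ X (suc j)
    now : suc j ≤ level X (suc n₁)
    now with level-step X n₁
    ... | inj₁ (eq , _) = ≤-trans (s≤s (reached n₁ (m≤m⊔n n₀ _))) (≤-reflexive (sym eq))
    ... | inj₂ (eq , lt) with m≤n⇒m<n∨m≡n (reached n₁ (m≤m⊔n n₀ _))
    ...   | inj₁ j<l = ≤-trans j<l (≤-reflexive (sym eq))
    ...   | inj₂ j≡l = contradiction (≤-trans (m≤n⊔m n₀ (X (suc j))) (n≤1+n n₁))
                         (<⇒≱ (subst (λ z → suc n₁ < X (suc z)) (sym j≡l) lt))

  level-< : ∀ X → 0 < X 1 → (∀ j → X j < X (suc j)) → ∀ n → n < X (suc (level X n))
  level-< X 0<X mono zero    = 0<X
  level-< X 0<X mono (suc n) with level-step X n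
  ... | inj₁ (eq , _)  = subst (λ z → suc n < X (suc z)) (sym eq) (≤-<-trans (level-< X 0<X mono n) (mono (suc (level X n))))
  ... | inj₂ (eq , lt) = subst (λ z → suc n < X (suc z)) (sym eq) lt

  step-mono : ∀ (X : ℕ → ℕ) → (∀ j → X j ≤ X (suc j)) → ∀ {i j} → i ≤ j → X i ≤ X j
  step-mono X mono {i} {j} i≤j = subst (λ z → X i ≤ X z) (m+[n∸m]≡n i≤j) (go (j ∸ i))
    where
    go : ∀ k → X i ≤ X (i + k)
    go zero    = ≤-reflexive (cong X (sym (+-identityʳ i)))
    go (suc k) = ≤-trans (go k) (≤-trans (mono (i + k)) (≤-reflexive (cong X (sym (+-suc i k)))))

  -- Size of the box, the base and the scale at stage j

  module Parameters (j : ℕ) where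

    -- D and B must not unfold, lest comparing natural numbers evaluate factorials.
    abstract
      D B : ℕ
      D = (j !) ^ suc j
      B = 2 * (D * D) * suc j

      0<D : 0 < D
      0<D = m^n>0 (j !) {{>-nonZero (1≤n! j)}} (suc j)

      D≤D² : D ≤ D * D
      D≤D² = ≤-trans (≤-reflexive (sym (*-identityʳ D))) (*-monoʳ-≤ D 0<D)

      0<B : 0 < B
      0<B = *-mono-≤ {1} {2 * (D * D)} (*-mono-≤ {1} {2} (s≤s z≤n) (*-mono-≤ 0<D 0<D)) (s≤s z≤n)

      -- The factor `2 * (D * D)` of `B` pays for this inequality, which separates the sets of
      -- different labels.
      room : D * D + D ≤ B
      room = begin
        D * D + D           ≤⟨ +-monoʳ-≤ (D * D) D≤D² ⟩
        D * D + D * D       ≡⟨ cong (D * D +_) (+-identityʳ (D * D)) ⟨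
        2 * (D * D)         ≤⟨ m≤m*n (2 * (D * D)) (suc j) ⟩
        B                   ∎
        where open ≤-Reasoning

      -- The factor `suc j` of `B` is chosen for this: the marked set has density d(D)/B, which has
      -- to tend to 0.
      divisors-≤ : divisors D * suc j ≤ B
      divisors-≤ = *-monoˡ-≤ (suc j) (begin
        divisors D          ≤⟨ #-bound _ (suc D) ⟩
        suc D               ≤⟨ +-mono-≤ 0<D ≤-refl ⟩
        D + D               ≤⟨ +-mono-≤ D≤D² D≤D² ⟩
        D * D + D * D       ≡⟨ cong (D * D +_) (+-identityʳ (D * D)) ⟨
        2 * (D * D)         ∎)
        where open ≤-Reasoning

      -- The base `j !` brings in every prime up to `j`, and the exponent `suc j` makes the box long
      -- enough in each such direction for `faces-small`.
      prime-power∣D : ∀ {p} → 0 < p → p ≤ j → p ^ suc j ∣ D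
      prime-power∣D {suc p} _ p≤j = ^-monoˡ-∣ (suc j) (∣-trans (divides (p !) (*-comm (suc p) (p !))) (m≤n⇒m!∣n! p≤j))
        where
        ^-monoˡ-∣ : ∀ k {a b} → a ∣ b → a ^ k ∣ b ^ k
        ^-monoˡ-∣ zero    _   = ∣-refl
        ^-monoˡ-∣ (suc k) a∣b = *-pres-∣ a∣b (^-monoˡ-∣ k a∣b)

      -- Serves the default level 0 in `B-stage≤`. It stands here because the value of `B` is
      -- visible only inside the abstract block.
      B≤2 : j ≡ 0 → B ≤ 2
      B≤2 eq = ≤-reflexive (cong (λ j → 2 * ((j !) ^ suc j * (j !) ^ suc j) * suc j) eq)

    -- Through `D`, every prime `p ≤ j` divides the scale, as dilation by `p` requires; the size
    -- (j+1) D B makes the at most `D * B` changes of the mark within a period rare.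
    P₀ T : ℕ
    P₀ = D * B * suc j
    T  = D * (B * P₀)

    0<P₀ : 0 < P₀
    0<P₀ = *-mono-≤ (*-mono-≤ 0<D 0<B) (s≤s z≤n)

    p∣P₀ : ∀ {p} → 0 < p → p ≤ j → p ∣ P₀
    p∣P₀ {p} 0<p p≤j = ∣m⇒∣m*n (suc j) (∣m⇒∣m*n B (∣-trans (∣m⇒∣m*n (p ^ j) ∣-refl) (prime-power∣D 0<p p≤j)))

  -- The relative error x = e / M satisfies x′ ≤ (1 − δ) x + δ (2 / k) with δ = h / (h + u) ≥ 1 / (L + 1);
  -- hence a bound x ≤ 2 / k + C / L becomes x′ ≤ 2 / k + C / (L + 1).
  error-recurrence : ∀ {k L C e e′ M h u G} → 0 < L → k * L * e ≤ (2 * L + C * k) * M →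
                     e′ ≤ e * u + G → k * G ≤ 2 * (M * h) → u ≤ h * L →
                     k * suc L * e′ ≤ (2 * suc L + C * k) * ((h + u) * M)
  error-recurrence {k} {L} {C} {e} {e′} {M} {h} {u} {G} 0<L bound step gap dense =
    *-cancelˡ-≤ L {{>-nonZero 0<L}} (begin
      L * (k * suc L * e′)                                     ≤⟨ *-monoʳ-≤ L (*-monoʳ-≤ (k * suc L) step) ⟩
      L * (k * suc L * (e * u + G))                            ≡⟨ expand k L e u G ⟩
      suc L * u * (k * L * e) + L * suc L * (k * G)            ≤⟨ +-mono-≤ (*-monoʳ-≤ (suc L * u) bound) (*-monoʳ-≤ (L * suc L) gap) ⟩
      suc L * u * ((2 * L + C * k) * M) + L * suc L * (2 * (M * h))
        ≡⟨ regroup k L C M h u ⟩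
      2 * (L * suc L * (h + u) * M) + C * k * M * (u + L * u)  ≤⟨ +-monoʳ-≤ _ (*-monoʳ-≤ (C * k * M) (+-monoˡ-≤ (L * u) dense)) ⟩
      2 * (L * suc L * (h + u) * M) + C * k * M * (h * L + L * u)
        ≡⟨ collect k L C M h u ⟩
      L * ((2 * suc L + C * k) * ((h + u) * M))                ∎)
    where
    open ≤-Reasoning
    expand : ∀ k L e u G → L * (k * suc L * (e * u + G)) ≡ suc L * u * (k * L * e) + L * suc L * (k * G)
    expand = solve-∀
    regroup : ∀ k L C M h u → suc L * u * ((2 * L + C * k) * M) + L * suc L * (2 * (M * h)) ≡
                              2 * (L * suc L * (h + u) * M) + C * k * M * (u + L * u)
    regroup = solve-∀
    collect : ∀ k L C M h u → 2 * (L * suc L * (h + u) * M) + C * k * M * (h * L + L * u) ≡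
                              L * ((2 * suc L + C * k) * ((h + u) * M))
    collect = solve-∀

  Null : (ℕ → Bool) → Set
  Null A = Vanishing (# A) (λ x → x)

  #-initial : ∀ a x → # (λ n → does (n <? a)) x ≤ a
  #-initial a x = ≤-trans (Σ<-≤ _ (m≤m⊔n x a)) (≤-trans (≤-reflexive (Σ<-vanish _ (m≤n⊔m x a)
      λ n a≤n → cong 𝕀 (dec-false (n <? a) (≤⇒≯ a≤n)))) (#-bound _ a))

  #-periodic-≤ : ∀ {m} A M → 0 < M → (∀ k n → A (n + k * M) ≡ A n) → m * # A M ≤ M → ∀ x → m * # A x ≤ x + M
  #-periodic-≤ {m} A M 0<M per small x = begin
    m * # A x                      ≤⟨ *-monoʳ-≤ m (Σ<-≤ _ x≤) ⟩
    m * # A (suc (x ÷ M) * M)      ≡⟨ cong (m *_) (#-periodic A M per (suc (x ÷ M))) ⟩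
    m * (suc (x ÷ M) * # A M)      ≡⟨ lemma m (suc (x ÷ M)) (# A M) ⟩
    suc (x ÷ M) * (m * # A M)      ≤⟨ *-monoʳ-≤ (suc (x ÷ M)) small ⟩
    M + x ÷ M * M                  ≡⟨ +-comm M (x ÷ M * M) ⟩
    x ÷ M * M + M                  ≤⟨ +-monoˡ-≤ M (≤-trans (m≤m+n (x ÷ M * M) (x mod M)) (≤-reflexive (sym (divMod x 0<M)))) ⟩
    x + M                          ∎
    where
    open ≤-Reasoning
    lemma : ∀ m t a → m * (t * a) ≡ t * (m * a)
    lemma = solve-∀
    x≤ : x ≤ suc (x ÷ M) * M
    x≤ = ≤-trans (≤-reflexive (divMod x 0<M))
      (≤-trans (+-monoʳ-≤ (x ÷ M * M) (<⇒≤ (mod-< x 0<M))) (≤-reflexive (+-comm (x ÷ M * M) M)))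

  -- Sets T i with vanishing densities and periods N i, with T i used on [X i, X (i + 1)), combine into a null set:
  -- the previous thresholds and the periods are negligible against X i.
  module Glue (N X : ℕ → ℕ) (0<N : ∀ i → 0 < N i) (N-mono : ∀ i → N i ≤ N (suc i))
              (X-suc : ∀ i → X (suc i) ≡ (2 + i) * (X i + N (suc i))) where

    X-< : ∀ i → X i < X (suc i)
    X-< i = begin-strict
      X i                              <⟨ m<m+n (X i) (0<N (suc i)) ⟩
      X i + N (suc i)                  ≤⟨ m≤m+n (X i + N (suc i)) _ ⟩
      (2 + i) * (X i + N (suc i))      ≡⟨ X-suc i ⟨
      X (suc i)                        ∎
      where open ≤-Reasoning

    below : ∀ n → n < X (suc (level X n))
    below = level-< X (≤-<-trans z≤n (X-< 0)) X-<

    above : ∀ n {j} → level X n ≡ suc j → X (suc j) ≤ n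
    above n {j} eq with ≤-total n (X 0) | subst (λ z → X z ≤ n ⊔ X 0) eq (level-≤ X n)
    ... | inj₂ X0≤n | le = ≤-trans le (≤-reflexive (m≥n⇒m⊔n≡m X0≤n))
    ... | inj₁ n≤X0 | le = contradiction (≤-trans le (≤-reflexive (m≤n⇒m⊔n≡n n≤X0)))
                            (<⇒≱ (≤-<-trans (step-mono X (λ i → <⇒≤ (X-< i)) (z≤n {j})) (X-< j)))

    -- The ratio of `X (2 + j)` to `X (suc j)` exceeds `j`, while `φn` is at most `c * suc n` with
    -- `c ≤ j` and `n` lies below `X (suc j)`. So at most one threshold is crossed.
    level-φ : ∀ {c n φn} → n ≤ φn → φn ≤ c * suc n → c ≤ level X n →
              level X φn ≡ level X n ⊎ level X φn ≡ suc (level X n)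
    level-φ {c} {n} {φn} n≤φn φn≤ c≤ with m≤n⇒m<n∨m≡n (level-mono X n≤φn)
    ... | inj₂ eq = inj₁ (sym eq)
    ... | inj₁ lt with m≤n⇒m<n∨m≡n lt
    ...   | inj₂ eq = inj₂ (sym eq)
    ...   | inj₁ lt₂ = contradiction too-large (<-irrefl refl)
      where
      j = level X n
      open ≤-Reasoning
      reached : ∀ {l} → level X φn ≡ l → 2 + j ≤ l → X (2 + j) ≤ φn
      reached {suc l} eq le = ≤-trans (step-mono X (λ i → <⇒≤ (X-< i)) le) (above φn eq)
      too-large : φn < φn
      too-large = begin-strict
        φn                                    ≤⟨ φn≤ ⟩
        c * suc n                             ≤⟨ *-mono-≤ c≤ (below n) ⟩
        j * X (suc j)                         ≤⟨ *-monoˡ-≤ (X (suc j)) (m≤n+m j 2) ⟩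
        (2 + j) * X (suc j)                   <⟨ *-monoʳ-< (2 + j) (m<m+n (X (suc j)) (0<N (2 + j))) ⟩
        (2 + j) * (X (suc j) + N (2 + j))     ≤⟨ m≤n+m _ (X (suc j) + N (2 + j)) ⟩
        (3 + j) * (X (suc j) + N (2 + j))     ≡⟨ X-suc (suc j) ⟨
        X (2 + j)                             ≤⟨ reached refl lt₂ ⟩
        φn                                    ∎

    -- Below an `x` of level `suc j`, a point of `A` lies below `n₀`, below `X j`, in `T j` or in
    -- `T (suc j)`. Multiplied by `4 * m`, these sources cost at most `x`, `j * X j` and twice
    -- `x + N (suc j)`; the recursion for `X` absorbs everything but `3 * x` into `X (suc j)`, which
    -- is at most `x`.
    glue : (T : ℕ → ℕ → Bool) → (∀ i k n → T i (n + k * N i) ≡ T i n) →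
           Vanishing (λ i → # (T i) (N i)) N →
           ∀ {A} n₀ → (∀ n → n₀ ≤ n → A n ≡ true → T (level X n) n ≡ true) → Null A
    glue T per v {A} n₀ cover m with v (4 * m)
    ... | i₀ , small with level-unbounded X (suc (i₀ ⊔ 4 * m))
    ...   | x₁ , high = x₀ , bound
      where
      x₀ = x₁ ⊔ 4 * m * n₀
      bound : ∀ x → x₀ ≤ x → m * # A x ≤ x
      bound x x₀≤x with level X x in eq | high x (≤-trans (m≤m⊔n x₁ _) x₀≤x)
      ... | suc j | s≤s j≥ = *-cancelˡ-≤ 4 (begin
        4 * (m * # A x)
          ≡⟨ *-assoc 4 m (# A x) ⟨
        4 * m * # A x
          ≤⟨ *-monoʳ-≤ (4 * m) (Σ<-mono x covered) ⟩
        4 * m * Σ< x (λ n → 𝕀 (does (n <? n₀)) + 𝕀 (does (n <? X j)) + 𝕀 (T j n) + 𝕀 (T (suc j) n))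
          ≡⟨ cong (4 * m *_) (trans (Σ<-+ x _ _) (cong (_+ # (T (suc j)) x) (trans (Σ<-+ x _ _) (cong (_+ # (T j) x) (Σ<-+ x _ _))))) ⟩
        4 * m * (# (λ n → does (n <? n₀)) x + # (λ n → does (n <? X j)) x + # (T j) x + # (T (suc j)) x)
          ≤⟨ *-monoʳ-≤ (4 * m) (+-monoˡ-≤ _ (+-monoˡ-≤ _ (+-mono-≤ (#-initial n₀ x) (#-initial (X j) x)))) ⟩
        4 * m * (n₀ + X j + # (T j) x + # (T (suc j)) x)
          ≡⟨ distrib (4 * m) n₀ (X j) (# (T j) x) (# (T (suc j)) x) ⟩
        4 * m * n₀ + 4 * m * X j + 4 * m * # (T j) x + 4 * m * # (T (suc j)) x
          ≤⟨ +-mono-≤ (+-mono-≤ (+-mono-≤ (≤-trans (m≤n⊔m x₁ _) x₀≤x) (*-monoˡ-≤ (X j) (≤-trans (m≤n⊔m i₀ (4 * m)) j≥)))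
               (≤-trans (#-periodic-≤ {4 * m} (T j) (N j) (0<N j) (per j) (small j i₀≤j) x) (+-monoʳ-≤ x (N-mono j))))
               (#-periodic-≤ {4 * m} (T (suc j)) (N (suc j)) (0<N (suc j)) (per (suc j)) (small (suc j) (≤-trans i₀≤j (n≤1+n j))) x) ⟩
        x + j * X j + (x + N (suc j)) + (x + N (suc j))
          ≡⟨ regroup x (j * X j) (N (suc j)) ⟩
        3 * x + (j * X j + 2 * N (suc j))
          ≤⟨ +-monoʳ-≤ (3 * x) (≤-trans (+-mono-≤ (*-monoˡ-≤ (X j) (m≤n+m j 2)) (*-monoˡ-≤ (N (suc j)) (m≤m+n 2 j)))
               (≤-reflexive (sym (*-distribˡ-+ (2 + j) (X j) (N (suc j)))))) ⟩
        3 * x + (2 + j) * (X j + N (suc j))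
          ≡⟨ cong (3 * x +_) (X-suc j) ⟨
        3 * x + X (suc j)
          ≤⟨ +-monoʳ-≤ (3 * x) (above x eq) ⟩
        3 * x + x
          ≡⟨ +-comm (3 * x) x ⟩
        4 * x ∎)
        where
        open ≤-Reasoning
        i₀≤j : i₀ ≤ j
        i₀≤j = ≤-trans (m≤m⊔n i₀ (4 * m)) j≥
        distrib : ∀ m a b c d → m * (a + b + c + d) ≡ m * a + m * b + m * c + m * d
        distrib = solve-∀
        regroup : ∀ x a n → x + a + (x + n) + (x + n) ≡ 3 * x + (a + 2 * n)
        regroup = solve-∀
        bit : ∀ {b : Bool} {a} → b ≡ true → a ≤ 1 → a ≤ 𝕀 b
        bit refl le = le
        in₁ : ∀ b c d {a} → a ≤ a + b + c + d
        in₁ b c d {a} = ≤-trans (m≤m+n a b) (≤-trans (m≤m+n (a + b) c) (m≤m+n (a + b + c) d))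
        in₂ : ∀ a c d {b} → b ≤ a + b + c + d
        in₂ a c d {b} = ≤-trans (m≤n+m b a) (≤-trans (m≤m+n (a + b) c) (m≤m+n (a + b + c) d))
        covered : ∀ n → n < x → 𝕀 (A n) ≤ 𝕀 (does (n <? n₀)) + 𝕀 (does (n <? X j)) + 𝕀 (T j n) + 𝕀 (T (suc j) n)
        covered n n<x with A n in An
        ... | false = z≤n
        ... | true with <-≤-connex n n₀
        ...   | inj₁ n<n₀ = ≤-trans (bit (dec-true (n <? n₀) n<n₀) ≤-refl) (in₁ (𝕀 (does (n <? X j))) (𝕀 (T j n)) (𝕀 (T (suc j) n)))
        ...   | inj₂ n₀≤n with cover n n₀≤n An | m≤n⇒m<n∨m≡n (subst (level X n ≤_) eq (level-mono X (<⇒≤ n<x)))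
        ...     | Tn | inj₂ l≡ = ≤-trans (bit (subst (λ z → T z n ≡ true) l≡ Tn) ≤-refl)
                                         (m≤n+m (𝕀 (T (suc j) n)) (𝕀 (does (n <? n₀)) + 𝕀 (does (n <? X j)) + 𝕀 (T j n)))
        ...     | Tn | inj₁ (s≤s l≤j) with m≤n⇒m<n∨m≡n l≤j
        ...       | inj₂ l≡ = ≤-trans (bit (subst (λ z → T z n ≡ true) l≡ Tn) ≤-refl)
                                (≤-trans (m≤n+m (𝕀 (T j n)) (𝕀 (does (n <? n₀)) + 𝕀 (does (n <? X j)))) (m≤m+n _ (𝕀 (T (suc j) n))))
        ...       | inj₁ l<j = ≤-trans (bit (dec-true (n <? X j) (<-≤-trans (below n) (step-mono X (λ i → <⇒≤ (X-< i)) l<j))) ≤-refl)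
                                (in₂ (𝕀 (does (n <? n₀))) (𝕀 (T j n)) (𝕀 (T (suc j) n)))

  -- The slowly varying sign S

  module Tower (ψ : ℕ → Sign) where

    open Parameters

    module _ (j : ℕ) where
      open Mark ψ (D j) (B j) public

    marks : ℕ → ℕ
    marks j = # (At.marked j (P₀ j)) (T j)

    marks≡ : ∀ j → marks j ≡ divisors (D j) * (D j * P₀ j)
    marks≡ j = #-marked j (0<D j) (room j) (0<P₀ j)

    -- Because 1 divides `D`, the marks have density at least 1/B. This crude bound is enough, as
    -- `stage` keeps `B` at most `2 + i` at step `i`.
    T≤marks : ∀ j → T j ≤ marks j * B j
    T≤marks j = begin
      D j * (B j * P₀ j)                      ≡⟨ lemma (D j) (B j) (P₀ j) ⟩
      1 * (D j * P₀ j) * B j                  ≤⟨ *-monoˡ-≤ (B j) (*-monoˡ-≤ (D j * P₀ j) (divisors≥1 (0<D j))) ⟩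
      divisors (D j) * (D j * P₀ j) * B j     ≡⟨ cong (_* B j) (marks≡ j) ⟨
      marks j * B j                           ∎
      where
      open ≤-Reasoning
      lemma : ∀ d b p → d * (b * p) ≡ 1 * (d * p) * b
      lemma = solve-∀

    marks≤T : ∀ j → suc j * marks j ≤ T j
    marks≤T j = begin
      suc j * marks j                          ≡⟨ cong (suc j *_) (marks≡ j) ⟩
      suc j * (divisors (D j) * (D j * P₀ j))  ≡⟨ lemma (suc j) (divisors (D j)) (D j) (P₀ j) ⟩
      D j * (divisors (D j) * suc j * P₀ j)    ≤⟨ *-monoʳ-≤ (D j) (*-monoˡ-≤ (P₀ j) (divisors-≤ j)) ⟩
      T j                                      ∎
      where
      open ≤-Reasoning
      lemma : ∀ k n d p → k * (n * (d * p)) ≡ d * (n * k * p)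
      lemma = solve-∀

    -- The gaps are measured against the `M * marks j` marked points of a period, not against the
    -- period itself: in `error-recurrence` the new errors must be a small proportion of the part
    -- that is overridden.
    GapSmall : (ℕ → ℕ) → Sign → ℕ → Set
    GapSmall φ w j = ∀ M → 0 < M → suc j * # (At.gap j (P₀ j * M) φ w) (D j * (B j * (P₀ j * M))) ≤ 2 * (M * marks j)

    gapSmall-suc : ∀ j → GapSmall suc Sign.+ j
    gapSmall-suc j M 0<M = begin
      suc j * # (At.gap j (P₀ j * M) suc Sign.+) (D j * (B j * (P₀ j * M)))
        ≤⟨ *-monoʳ-≤ (suc j) (#-gap-suc j (0<D j) (room j) (*-mono-≤ (0<P₀ j) 0<M)) ⟩
      suc j * (D j * B j)                 ≡⟨ *-comm (suc j) (D j * B j) ⟩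
      P₀ j                                ≡⟨ lemma (P₀ j) ⟩
      1 * (1 * (1 * (1 * P₀ j)))              ≤⟨ *-mono-≤ {1} {2} (s≤s z≤n)
                                              (*-mono-≤ 0<M (*-mono-≤ (divisors≥1 (0<D j)) (*-monoˡ-≤ (P₀ j) (0<D j)))) ⟩
      2 * (M * (divisors (D j) * (D j * P₀ j)))
        ≤⟨ *-monoʳ-≤ 2 (*-monoʳ-≤ M (≤-reflexive (sym (marks≡ j)))) ⟩
      2 * (M * marks j)                   ∎
      where
      open ≤-Reasoning
      lemma : ∀ p → p ≡ 1 * (1 * (1 * (1 * p)))
      lemma = solve-∀

    gapSmall-* : ∀ {p} → Prime p → (∀ q → 0 < q → ψ (p * q) ≡ ψ p Sign.* ψ q) →
                 ∀ j → p ≤ j → GapSmall (p *_) (ψ p) j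
    gapSmall-* {p} pp ψ-* j p≤j M 0<M = begin
      suc j * # (At.gap j (P₀ j * M) (p *_) (ψ p)) (D j * (B j * (P₀ j * M)))
        ≤⟨ *-monoʳ-≤ (suc j) (#-gap j (0<D j) (room j) (*-mono-≤ (0<P₀ j) 0<M) pp (∣m⇒∣m*n M (p∣P₀ j 0<p p≤j)) ψ-*) ⟩
      suc j * ((highFace p (D j) + lowFace p (D j)) * (D j * (P₀ j * M)))
        ≡⟨ *-assoc (suc j) (highFace p (D j) + lowFace p (D j)) (D j * (P₀ j * M)) ⟨
      suc j * (highFace p (D j) + lowFace p (D j)) * (D j * (P₀ j * M))
        ≤⟨ *-monoˡ-≤ (D j * (P₀ j * M)) (faces-small pp j (0<D j) (prime-power∣D j 0<p p≤j)) ⟩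
      2 * divisors (D j) * (D j * (P₀ j * M))
        ≡⟨ lemma (divisors (D j)) (D j) (P₀ j) M ⟩
      2 * (M * (divisors (D j) * (D j * P₀ j)))
        ≡⟨ cong (λ z → 2 * (M * z)) (marks≡ j) ⟨
      2 * (M * marks j) ∎
      where
      open ≤-Reasoning
      0<p : 0 < p
      0<p = >-nonZero⁻¹ p {{prime⇒nonZero pp}}
      lemma : ∀ n d p m → 2 * n * (d * (p * m)) ≡ 2 * (m * (n * (d * p)))
      lemma = solve-∀

    -- Using the values of `B` as thresholds delays each stage until its marks, of density at least
    -- 1/B, are at least as dense as 1/(i+2) at step `i`; the sum over steps then diverges.
    stage : ℕ → ℕ
    stage = level B

    B-stage≤ : ∀ i → B (stage i) ≤ 2 + i
    B-stage≤ i = ≤-trans (level-≤ B i) (⊔-lub (≤-trans (n≤1+n i) (n≤1+n (suc i))) (≤-trans (B≤2 0 refl) (m≤m+n 2 i)))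

    -- A period of `s i`. The next scale `P₀ (stage i) * M i` is a multiple of it, so `÷-block`
    -- makes the new marks independent of `s i`.
    M : ℕ → ℕ
    M zero    = 1
    M (suc i) = D (stage i) * (B (stage i) * (P₀ (stage i) * M i))

    0<M : ∀ i → 0 < M i
    0<M zero    = s≤s z≤n
    0<M (suc i) = *-mono-≤ (0<D (stage i)) (*-mono-≤ (0<B (stage i)) (*-mono-≤ (0<P₀ (stage i)) (0<M i)))

    M-suc : ∀ i → M (suc i) ≡ T (stage i) * M i
    M-suc i = lemma (D (stage i)) (B (stage i)) (P₀ (stage i)) (M i)
      where
      lemma : ∀ d b p m → d * (b * (p * m)) ≡ d * (b * p) * m
      lemma = solve-∀

    M≤M-suc : ∀ i → M i ≤ M (suc i)
    M≤M-suc i = subst (M i ≤_) (sym (M-suc i)) (subst (_≤ T (stage i) * M i) (*-identityˡ (M i))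
      (*-monoˡ-≤ (M i) (*-mono-≤ (0<D (stage i)) (*-mono-≤ (0<B (stage i)) (0<P₀ (stage i))))))

    markAt : ℕ → ℕ → Maybe Sign
    markAt i = At.mark (stage i) (P₀ (stage i) * M i)

    markedAt : ℕ → ℕ → Bool
    markedAt i = At.marked (stage i) (P₀ (stage i) * M i)

    s : ℕ → ℕ → Sign
    s zero    n = Sign.+
    s (suc i) n = fromMaybe (s i n) (markAt i n)

    0<PM : ∀ i → 0 < P₀ (stage i) * M i
    0<PM i = *-mono-≤ (0<P₀ (stage i)) (0<M i)

    s-+ : ∀ i k n → s i (n + k * M i) ≡ s i n
    s-+ zero    k n = refl
    s-+ (suc i) k n = cong₂ fromMaybe
      (trans (cong (λ z → s i (n + z)) (trans (cong (k *_) (M-suc i)) (sym (*-assoc k (T (stage i)) (M i)))))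
             (s-+ i (k * T (stage i)) n))
      (mark-+ (stage i) (0<D (stage i)) (room (stage i)) (0<PM i) k n)

    X : ℕ → ℕ
    X zero    = 1
    X (suc i) = (2 + i) * (X i + M (2 + i))

    open Glue (λ i → M (suc i)) X (λ i → 0<M (suc i)) (λ i → M≤M-suc (suc i)) (λ _ → refl)

    S : ℕ → Sign
    S n = s (level X n) n

    -- Treats the successor, with sign `+`, and multiplication by `p`, with sign `ψ p`, at once. The
    -- slope `c` ensures that `φ` carries shifts by a period to shifts by a multiple of it.
    module Twist (φ : ℕ → ℕ) (c : ℕ) (w : Sign) (φ-+ : ∀ n k → φ (n + k) ≡ φ n + c * k)
                 (n≤φn : ∀ n → n ≤ φ n) (φn≤ : ∀ n → φ n ≤ c * suc n)
                 (j₀ : ℕ) (gapSmall : ∀ j → j₀ ≤ j → GapSmall φ w j) where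

      bad : ℕ → ℕ → Bool
      bad i n = not (does (s i (φ n) Sign.≟ w Sign.* s i n))

      gapAt : ℕ → ℕ → Bool
      gapAt i = At.gap (stage i) (P₀ (stage i) * M i) φ w

      φ-+* : ∀ n k m → φ (n + k * m) ≡ φ n + c * k * m
      φ-+* n k m = trans (φ-+ n (k * m)) (cong (φ n +_) (sym (*-assoc c k m)))

      bad-+ : ∀ i k n → bad i (n + k * M i) ≡ bad i n
      bad-+ i k n = cong₂ (λ x y → not (does (x Sign.≟ w Sign.* y)))
        (trans (cong (s i) (φ-+* n k (M i))) (s-+ i (c * k) (φ n))) (s-+ i k n)

      gapAt-+ : ∀ i k n → gapAt i (n + k * M (suc i)) ≡ gapAt i n
      gapAt-+ i k n = cong₂ (λ x y → not (does (x ≟ᴹ Maybe.map (w Sign.*_) y)))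
        (trans (cong (markAt i) (φ-+* n k (M (suc i)))) (periodic (c * k) (φ n))) (periodic k n)
        where periodic = mark-+ (stage i) (0<D (stage i)) (room (stage i)) (0<PM i)

      -- Outside a gap, `n` and `φ n` are both marked, and then compatibly, or both unmarked, and
      -- then they keep their old values. The product form is what `e-step` factors.
      bad-step : ∀ i n → 𝕀 (bad (suc i) n) ≤ 𝕀 (bad i n) * 𝕀 (not (markedAt i n)) + 𝕀 (gapAt i n)
      bad-step i n with markAt i (φ n) ≟ᴹ Maybe.map (w Sign.*_) (markAt i n)
      ... | no _   = ≤-trans (𝕀≤1 _) (m≤n+m 1 _)
      ... | yes eq rewrite eq with markedAt i n
      ...   | true  rewrite dec-true (w Sign.* ψ (At.candidate (stage i) (P₀ (stage i) * M i) n) Sign.≟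
                                      w Sign.* ψ (At.candidate (stage i) (P₀ (stage i) * M i) n)) refl = z≤n
      ...   | false = ≤-reflexive (sym (trans (+-identityʳ _) (*-identityʳ _)))

      e : ℕ → ℕ
      e i = # (bad i) (M i)

      unmarked : ℕ → ℕ
      unmarked j = # (λ t → not (At.marked j (P₀ j) t)) (T j)

      marks+unmarked : ∀ j → marks j + unmarked j ≡ T j
      marks+unmarked j = trans (sym (#-split (λ _ → true) (At.marked j (P₀ j)) (T j)))
        (trans (Σ<-const (T j) 1) (*-identityʳ (T j)))

      marks≤T₁ : ∀ j → marks j ≤ T j
      marks≤T₁ j = ≤-trans (m≤m+n (marks j) (unmarked j)) (≤-reflexive (marks+unmarked j))

      -- Write n = t M + r: being bad depends only on `r` and being marked only on `t`, so the
      -- double sum splits into the product `e i * unmarked (stage i)`.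
      e-step : ∀ i → e (suc i) ≤ e i * unmarked (stage i) + # (gapAt i) (M (suc i))
      e-step i = begin
        e (suc i)
          ≤⟨ Σ<-mono (M (suc i)) (λ n _ → bad-step i n) ⟩
        Σ< (M (suc i)) (λ n → 𝕀 (bad i n) * 𝕀 (not (markedAt i n)) + 𝕀 (gapAt i n))
          ≡⟨ Σ<-+ (M (suc i)) _ _ ⟩
        Σ< (M (suc i)) (λ n → 𝕀 (bad i n) * 𝕀 (not (markedAt i n))) + # (gapAt i) (M (suc i))
          ≡⟨ cong (_+ # (gapAt i) (M (suc i))) total ⟩
        e i * unmarked (stage i) + # (gapAt i) (M (suc i)) ∎
        where
        open ≤-Reasoning
        j = stage i
        g : ℕ → ℕ
        g n = 𝕀 (bad i n) * 𝕀 (not (markedAt i n))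
        g-block : ∀ t r → r < M i → g (t * M i + r) ≡ 𝕀 (bad i r) * 𝕀 (not (At.marked j (P₀ j) t))
        g-block t r r<M = cong₂ (λ x y → 𝕀 x * 𝕀 (not y))
          (trans (cong (bad i) (+-comm (t * M i) r)) (bad-+ i t r))
          (marked-block j (P₀ j) (M i) t r<M)
        total : Σ< (M (suc i)) g ≡ e i * unmarked j
        total = begin-equality
          Σ< (M (suc i)) g                                       ≡⟨ cong (λ z → Σ< z g) (M-suc i) ⟩
          Σ< (T j * M i) g                                       ≡⟨ Σ<-blocks (T j) (M i) g ⟩
          Σ< (T j) (λ t → Σ< (M i) (λ r → g (t * M i + r)))      ≡⟨ Σ<-cong (T j) (λ t _ → trans (Σ<-cong (M i) λ r r<M → g-block t r r<M)
                                                                       (Σ<-*ʳ (M i) _ _)) ⟩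
          Σ< (T j) (λ t → e i * 𝕀 (not (At.marked j (P₀ j) t)))  ≡⟨ Σ<-*ˡ (T j) (e i) _ ⟩
          e i * unmarked j                                       ∎

      #-gapAt : ∀ i {k} → j₀ ≤ stage i → k ≤ suc (stage i) → k * # (gapAt i) (M (suc i)) ≤ 2 * (M i * marks (stage i))
      #-gapAt i j₀≤ k≤ = ≤-trans (*-monoˡ-≤ (# (gapAt i) (M (suc i))) k≤) (gapSmall (stage i) j₀≤ (M i) (0<M i))

      -- Induction by `error-recurrence` with k = J + 1 and L = i + 1, from a step where the stage
      -- has reached `J`. There the trivial bound of `e` by `M` is paid for by `C = suc i₀`.
      e-bound : ∀ J → j₀ ≤ J → ∃₂ λ i₀ C → ∀ i → i₀ ≤ i →
                suc J * suc i * e i ≤ (2 * suc i + C * suc J) * M i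
      e-bound J j₀≤J with level-unbounded B J
      ... | i₀ , J≤ = i₀ , suc i₀ , λ i i₀≤i → subst bounded (m+[n∸m]≡n i₀≤i) (go (i ∸ i₀))
        where
        bounded : ℕ → Set
        bounded i = suc J * suc i * e i ≤ (2 * suc i + suc i₀ * suc J) * M i
        start : bounded i₀
        start = *-mono-≤ (≤-trans (≤-reflexive (*-comm (suc J) (suc i₀))) (m≤n+m _ (2 * suc i₀))) (#-bound _ (M i₀))
        -- The harmonic lower bound: the marked proportion is at least 1/(i+2), so unmarked points
        -- outnumber marked ones at most (i+1)-fold.
        sparse : ∀ i → unmarked (stage i) ≤ marks (stage i) * suc i
        sparse i = +-cancelˡ-≤ (marks j) _ _ (begin
          marks j + unmarked j      ≡⟨ marks+unmarked j ⟩
          T j                       ≤⟨ T≤marks j ⟩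
          marks j * B j             ≤⟨ *-monoʳ-≤ (marks j) (B-stage≤ i) ⟩
          marks j * suc (suc i)     ≡⟨ *-suc (marks j) (suc i) ⟩
          marks j + marks j * suc i ∎)
          where
          open ≤-Reasoning
          j = stage i
        step : ∀ i → i₀ ≤ i → bounded i → bounded (suc i)
        step i i₀≤i b = subst (suc J * suc (suc i) * e (suc i) ≤_)
          (cong ((2 * suc (suc i) + suc i₀ * suc J) *_) (trans (cong (_* M i) (marks+unmarked (stage i))) (sym (M-suc i))))
          (error-recurrence {suc J} {suc i} {suc i₀} {e i} {e (suc i)} {M i} {marks (stage i)} {unmarked (stage i)}
             z<s b (e-step i) (#-gapAt i (≤-trans j₀≤J (J≤ i i₀≤i)) (s≤s (J≤ i i₀≤i))) (sparse i))
        go : ∀ d → bounded (i₀ + d)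
        go zero    = subst bounded (sym (+-identityʳ i₀)) start
        go (suc d) = subst bounded (sym (+-suc i₀ d)) (step (i₀ + d) (m≤m+n i₀ d) (go d))

      e-vanishing : Vanishing e M
      -- A stage of at least `4 * m` makes 2/k at most 1/(2m), and `i` beyond `2 * m * C` does the
      -- same for C/(i+1).
      e-vanishing m with e-bound (j₀ ⊔ 4 * m) (m≤m⊔n j₀ (4 * m))
      ... | i₀ , C , bound = i₀ ⊔ 2 * m * C , λ i i≥ →
        *-cancelˡ-≤ (2 * (k * suc i)) {{>-nonZero (*-mono-≤ {1} {2} (s≤s z≤n) (*-mono-≤ {1} {k} (s≤s z≤n) (s≤s z≤n)))}} (begin
          2 * (k * suc i) * (m * e i)                       ≡⟨ expand k (suc i) m (e i) ⟩
          2 * m * (k * suc i * e i)                         ≤⟨ *-monoʳ-≤ (2 * m) (bound i (≤-trans (m≤m⊔n i₀ _) i≥)) ⟩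
          2 * m * ((2 * suc i + C * k) * M i)               ≡⟨ regroup m (suc i) C k (M i) ⟩
          (4 * m * suc i + 2 * m * C * k) * M i             ≤⟨ *-monoˡ-≤ (M i) (+-mono-≤
                                                                (*-monoˡ-≤ (suc i) (≤-trans (m≤n⊔m j₀ (4 * m)) (n≤1+n _)))
                                                                (*-monoˡ-≤ k (≤-trans (m≤n⊔m i₀ _) (≤-trans i≥ (n≤1+n i))))) ⟩
          (k * suc i + suc i * k) * M i                     ≡⟨ collect k (suc i) (M i) ⟩
          2 * (k * suc i) * M i                             ∎)
        where
        open ≤-Reasoning
        k = suc (j₀ ⊔ 4 * m)
        expand : ∀ k L m e → 2 * (k * L) * (m * e) ≡ 2 * m * (k * L * e)
        expand = solve-∀
        regroup : ∀ m L C k M → 2 * m * ((2 * L + C * k) * M) ≡ (4 * m * L + 2 * m * C * k) * M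
        regroup = solve-∀
        collect : ∀ k L M → (k * L + L * k) * M ≡ 2 * (k * L) * M
        collect = solve-∀

      N : ℕ → ℕ
      N i = M (suc i)

      -- Marked points are discarded as well: when a threshold separates `n` from `φ n`, the values
      -- compared are `s i n` and `s (suc i) (φ n)`, and an unmarked point outside the gaps lets the
      -- latter fall back on `s i (φ n)`.
      exceptional : ℕ → ℕ → Bool
      exceptional i n = bad i n ∨ (gapAt i n ∨ markedAt i n)

      exceptional-+ : ∀ i k n → exceptional i (n + k * N i) ≡ exceptional i n
      exceptional-+ i k n = cong₂ _∨_
        (trans (cong (λ z → bad i (n + z)) (trans (cong (k *_) (M-suc i)) (sym (*-assoc k (T (stage i)) (M i)))))
               (bad-+ i (k * T (stage i)) n))
        (cong₂ _∨_ (gapAt-+ i k n)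
        (marked-+ (stage i) (0<D (stage i)) (room (stage i)) (0<PM i) k n))

      bad-vanishing : Vanishing (λ i → # (bad i) (N i)) N
      bad-vanishing m with e-vanishing m
      ... | i₀ , small = i₀ , λ i i₀≤i → begin
        m * # (bad i) (N i)                   ≡⟨ cong (λ z → m * # (bad i) z) (M-suc i) ⟩
        m * # (bad i) (T (stage i) * M i)     ≡⟨ cong (m *_) (#-periodic (bad i) (M i) (bad-+ i) (T (stage i))) ⟩
        m * (T (stage i) * e i)               ≡⟨ lemma m (T (stage i)) (e i) ⟩
        T (stage i) * (m * e i)               ≤⟨ *-monoʳ-≤ (T (stage i)) (small i i₀≤i) ⟩
        T (stage i) * M i                     ≡⟨ M-suc i ⟨
        N i                                   ∎
        where
        open ≤-Reasoning
        lemma : ∀ m t e → m * (t * e) ≡ t * (m * e)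
        lemma = solve-∀

      gapAt-vanishing : Vanishing (λ i → # (gapAt i) (N i)) N
      gapAt-vanishing m with level-unbounded B (j₀ ⊔ 2 * m)
      ... | i₀ , high = i₀ , λ i i₀≤i → *-cancelˡ-≤ 2 (begin
        2 * (m * # (gapAt i) (N i))           ≡⟨ *-assoc 2 m (# (gapAt i) (N i)) ⟨
        2 * m * # (gapAt i) (N i)             ≤⟨ #-gapAt i (≤-trans (m≤m⊔n j₀ _) (high i i₀≤i))
                                                   (≤-trans (m≤n⊔m j₀ _) (≤-trans (high i i₀≤i) (n≤1+n (stage i)))) ⟩
        2 * (M i * marks (stage i))           ≡⟨ cong (2 *_) (*-comm (M i) (marks (stage i))) ⟩
        2 * (marks (stage i) * M i)           ≤⟨ *-monoʳ-≤ 2 (*-monoˡ-≤ (M i) (marks≤T₁ (stage i))) ⟩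
        2 * (T (stage i) * M i)               ≡⟨ cong (2 *_) (M-suc i) ⟨
        2 * N i                               ∎)
        where open ≤-Reasoning

      markedAt-vanishing : Vanishing (λ i → # (markedAt i) (N i)) N
      markedAt-vanishing m with level-unbounded B m
      ... | i₀ , high = i₀ , λ i i₀≤i → begin
        m * # (markedAt i) (N i)              ≡⟨ cong (m *_) (#-markedAt i) ⟩
        m * (marks (stage i) * M i)           ≤⟨ *-monoˡ-≤ (marks (stage i) * M i) (≤-trans (high i i₀≤i) (n≤1+n (stage i))) ⟩
        suc (stage i) * (marks (stage i) * M i) ≡⟨ *-assoc (suc (stage i)) (marks (stage i)) (M i) ⟨
        suc (stage i) * marks (stage i) * M i ≤⟨ *-monoˡ-≤ (M i) (marks≤T (stage i)) ⟩
        T (stage i) * M i                     ≡⟨ M-suc i ⟨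
        N i                                   ∎
        where
        open ≤-Reasoning
        #-markedAt : ∀ i → # (markedAt i) (N i) ≡ marks (stage i) * M i
        #-markedAt i = begin-equality
          # (markedAt i) (N i)                                   ≡⟨ #-marked j (0<D j) (room j) (0<PM i) ⟩
          divisors (D j) * (D j * (P₀ j * M i))                  ≡⟨ lemma (divisors (D j)) (D j) (P₀ j) (M i) ⟩
          divisors (D j) * (D j * P₀ j) * M i                    ≡⟨ cong (_* M i) (marks≡ j) ⟨
          marks j * M i                                          ∎
          where
          j = stage i
          lemma : ∀ n d p m → n * (d * (p * m)) ≡ n * (d * p) * m
          lemma = solve-∀

      exceptional-vanishing : Vanishing (λ i → # (exceptional i) (N i)) N
      exceptional-vanishing = vanishing-≤ (0 , λ i _ → ≤-trans (Σ<-mono (N i) λ n _ → union (bad i n) (gapAt i n) (markedAt i n))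
          (≤-reflexive (trans (Σ<-+ (N i) _ _) (cong (_+ # (markedAt i) (N i)) (Σ<-+ (N i) _ _)))))
        (vanishing-+ (vanishing-+ bad-vanishing gapAt-vanishing) markedAt-vanishing)
        where
        union : ∀ a b c → 𝕀 (a ∨ (b ∨ c)) ≤ 𝕀 a + 𝕀 b + 𝕀 c
        union true  b     c = s≤s z≤n
        union false true  c = s≤s z≤n
        union false false c = ≤-refl

      module _ (i n : ℕ) (ok : exceptional i n ≡ false) where

        unexceptional : s i (φ n) ≡ w Sign.* s i n
        unexceptional = not-does (s i (φ n) Sign.≟ w Sign.* s i n) (∨-falseˡ (bad i n) ok)

        unexceptional-suc : s (suc i) (φ n) ≡ w Sign.* s i n
        unexceptional-suc = trans (cong (fromMaybe (s i (φ n))) φ-unmarked) unexceptional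
          where
          ok′ : gapAt i n ∨ markedAt i n ≡ false
          ok′ = ∨-falseʳ (bad i n) ok
          φ-unmarked : markAt i (φ n) ≡ nothing
          φ-unmarked = trans
            (not-does (markAt i (φ n) ≟ᴹ Maybe.map (w Sign.*_) (markAt i n)) (∨-falseˡ (gapAt i n) ok′))
            (cong (Maybe.map (w Sign.*_)) (unmarked⇒nothing (stage i) (P₀ (stage i) * M i) n (∨-falseʳ (gapAt i n) ok′)))

      -- By `level-φ`, the value at `φ n` comes from the approximant used at `n` or from the next
      -- one; the two cases of unexceptional points match these.
      S-twisted : Null (λ n → not (does (S (φ n) Sign.≟ w Sign.* S n)))
      S-twisted with level-unbounded X c
      ... | n₀ , high = glue exceptional exceptional-+ exceptional-vanishing n₀
          λ n n₀≤n → contrapositive _ _ λ ok → cong not (dec-true (S (φ n) Sign.≟ w Sign.* S n) (agreement n n₀≤n ok))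
        where
        agreement : ∀ n → n₀ ≤ n → exceptional (level X n) n ≡ false → S (φ n) ≡ w Sign.* S n
        agreement n n₀≤n ok with level-φ (n≤φn n) (φn≤ n) (high n n₀≤n)
        ... | inj₁ eq = trans (cong (λ z → s z (φ n)) eq) (unexceptional (level X n) n ok)
        ... | inj₂ eq = trans (cong (λ z → s z (φ n)) eq) (unexceptional-suc (level X n) n ok)

    S-suc : Null (λ n → not (does (S (suc n) Sign.≟ S n)))
    S-suc = Twist.S-twisted suc 1 Sign.+ (λ n k → cong (λ z → suc (n + z)) (sym (+-identityʳ k))) n≤1+n
      (λ n → ≤-reflexive (sym (*-identityˡ (suc n)))) 0 (λ j _ → gapSmall-suc j)

    S-* : ∀ {p} → Prime p → (∀ q → 0 < q → ψ (p * q) ≡ ψ p Sign.* ψ q) →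
          Null (λ n → not (does (S (p * n) Sign.≟ ψ p Sign.* S n)))
    S-* {p} pp ψ-* = Twist.S-twisted (p *_) p (ψ p) (*-distribˡ-+ p) (λ n → m≤n*m n p)
      (λ n → *-monoʳ-≤ p (n≤1+n n)) p (gapSmall-* pp ψ-*)
      where instance _ = prime⇒nonZero pp

  -- Completely multiplicative signs

  open PrimeFactorisation using (factors)

  ∏ : (ℕ → Sign) → List ℕ → Sign
  ∏ g []       = Sign.+
  ∏ g (p ∷ ps) = g p Sign.* ∏ g ps

  ∏-↭ : ∀ g {ps qs} → ps Perm.↭ qs → ∏ g ps ≡ ∏ g qs
  ∏-↭ g Perm.refl = refl
  ∏-↭ g (Perm.prep p π) = cong (g p Sign.*_) (∏-↭ g π)
  ∏-↭ g (Perm.swap {ps} {qs} p q π) = begin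
    g p Sign.* (g q Sign.* ∏ g ps)   ≡⟨ Sign.*-assoc (g p) (g q) (∏ g ps) ⟨
    g p Sign.* g q Sign.* ∏ g ps     ≡⟨ cong₂ Sign._*_ (Sign.*-comm (g p) (g q)) (∏-↭ g π) ⟩
    g q Sign.* g p Sign.* ∏ g qs     ≡⟨ Sign.*-assoc (g q) (g p) (∏ g qs) ⟩
    g q Sign.* (g p Sign.* ∏ g qs)   ∎
    where open ≡-Reasoning
  ∏-↭ g (Perm.trans π ρ) = trans (∏-↭ g π) (∏-↭ g ρ)

  -- The completely multiplicative function with values g p at the primes p (junk value + at 0).
  extend : (ℕ → Sign) → ℕ → Sign
  extend g zero      = Sign.+
  extend g n@(suc _) = ∏ g (factors (factorise n))

  extend-∏ : ∀ g {n} → 0 < n → (F : PrimeFactorisation n) → extend g n ≡ ∏ g (factors F)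
  extend-∏ g {suc n} _ F = ∏-↭ g (factorisationUnique (factorise (suc n)) F)

  extend-prime-* : ∀ g {p n} → Prime p → 0 < n → extend g (p * n) ≡ g p Sign.* extend g n
  extend-prime-* g {p} {n@(suc _)} pp 0<n = extend-∏ g (*-mono-≤ (>-nonZero⁻¹ p {{prime⇒nonZero pp}}) 0<n) (record
    { factors         = p ∷ factors F
    ; isFactorisation = cong (p *_) (PrimeFactorisation.isFactorisation F)
    ; factorsPrime    = pp ∷ PrimeFactorisation.factorsPrime F
    })
    where F = factorise n

  extend-prime : ∀ g {p} → Prime p → extend g p ≡ g p
  extend-prime g {p} pp = begin
    extend g p                 ≡⟨ cong (extend g) (*-identityʳ p) ⟨
    extend g (p * 1)           ≡⟨ extend-prime-* g pp z<s ⟩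
    g p Sign.* Sign.+          ≡⟨ Sign.*-identityʳ (g p) ⟩
    g p                        ∎
    where open ≡-Reasoning

  -- The nonprincipal character mod 3, except that multiples of 3 get the sign −.
  χ₃ : ℕ → Sign
  χ₃ n = if does (n % 3 ≟ 1) then Sign.+ else Sign.-

  -- Multiplicativity breaks down at multiples of 3, as 9 has sign - although 3 · 3 would give +.
  -- The two extra conclusions pass the hypothesis on to the tail in `∏-χ₃`.
  χ₃-* : ∀ m n → m * n % 3 ≢ 0 → χ₃ (m * n) ≡ χ₃ m Sign.* χ₃ n × m % 3 ≢ 0 × n % 3 ≢ 0
  χ₃-* m n mn≢0 = go (m % 3) (n % 3) (m%n<n m 3) (m%n<n n 3) (m * n % 3) (%-distribˡ-* m n 3) mn≢0
    where
    sgn : ℕ → Sign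
    sgn r = if does (r ≟ 1) then Sign.+ else Sign.-
    go : ∀ a b → a < 3 → b < 3 → ∀ c → c ≡ a * b % 3 → c ≢ 0 → sgn c ≡ sgn a Sign.* sgn b × a ≢ 0 × b ≢ 0
    go 0 b _ _ c eq c≢0 = contradiction eq c≢0
    go 1 0 _ _ c eq c≢0 = contradiction eq c≢0
    go 2 0 _ _ c eq c≢0 = contradiction eq c≢0
    go 1 1 _ _ c refl _ = refl , (λ ()) , (λ ())
    go 1 2 _ _ c refl _ = refl , (λ ()) , (λ ())
    go 2 1 _ _ c refl _ = refl , (λ ()) , (λ ())
    go 2 2 _ _ c refl _ = refl , (λ ()) , (λ ())
    go (suc (suc (suc _))) _ (s≤s (s≤s (s≤s ()))) _ _ _ _
    go 1 (suc (suc (suc _))) _ (s≤s (s≤s (s≤s ()))) _ _ _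
    go 2 (suc (suc (suc _))) _ (s≤s (s≤s (s≤s ()))) _ _ _

  ∏-χ₃ : ∀ ps → product ps % 3 ≢ 0 → ∏ χ₃ ps ≡ χ₃ (product ps)
  ∏-χ₃ []       _   = refl
  ∏-χ₃ (p ∷ ps) ≢0 with χ₃-* p (product ps) ≢0
  ... | eq , _ , ps≢0 = trans (cong (χ₃ p Sign.*_) (∏-χ₃ ps ps≢0)) (sym eq)

  -- Their product on positive integers is the Liouville function, since their values at each prime
  -- are opposite.
  κ ψ : ℕ → Sign
  κ = extend χ₃
  ψ = extend (λ p → Sign.opposite (χ₃ p))

  κ≡χ₃ : ∀ n → n % 3 ≢ 0 → κ n ≡ χ₃ n
  κ≡χ₃ zero      ≢0 = contradiction refl ≢0
  κ≡χ₃ n@(suc _) ≢0 = trans (∏-χ₃ (factors F) (subst (λ z → z % 3 ≢ 0) eq ≢0)) (cong χ₃ (sym eq))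
    where
    F  = factorise n
    eq = PrimeFactorisation.isFactorisation F

  κ-1mod3 : ∀ n → n % 3 ≡ 1 → κ n ≡ Sign.+
  κ-1mod3 n eq = trans (κ≡χ₃ n (λ ≡0 → contradiction (trans (sym eq) ≡0) λ ()))
                         (cong (λ r → if does (r ≟ 1) then Sign.+ else Sign.-) eq)

  κ-2mod3 : ∀ n → n % 3 ≡ 2 → κ n ≡ Sign.-
  κ-2mod3 n eq = trans (κ≡χ₃ n (λ ≡0 → contradiction (trans (sym eq) ≡0) λ ()))
                         (cong (λ r → if does (r ≟ 1) then Sign.+ else Sign.-) eq)

  ψ-prime-* : ∀ {p} → Prime p → ∀ q → 0 < q → ψ (p * q) ≡ ψ p Sign.* ψ q
  ψ-prime-* {p} pp q 0<q = trans (extend-prime-* _ pp 0<q) (cong (Sign._* ψ q) (sym (extend-prime _ pp)))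

  -- Null sets under unions and shifts; windows with a constant sign

  null-none : Null (λ _ → false)
  null-none m = 0 , λ x _ → subst (_≤ x) (sym (trans (cong (m *_) (#-none x _ λ _ _ → refl)) (*-zeroʳ m))) z≤n

  null-∨ : ∀ {A C} → Null A → Null C → Null (λ n → A n ∨ C n)
  null-∨ {A} {C} nA nC = vanishing-≤ (0 , λ x _ → ≤-trans (Σ<-mono x λ n _ → union (A n) (C n)) (≤-reflexive (Σ<-+ x _ _)))
                                     (vanishing-+ nA nC)
    where
    union : ∀ a b → 𝕀 (a ∨ b) ≤ 𝕀 a + 𝕀 b
    union true  b = s≤s z≤n
    union false b = ≤-refl

  null-shift : ∀ {A} h → Null A → Null (λ n → A (h + n))
  null-shift {A} h nA m with nA (2 * m)
  ... | x₀ , small = x₀ ⊔ h , λ x x≥ → *-cancelˡ-≤ 2 (begin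
    2 * (m * # (λ n → A (h + n)) x)           ≡⟨ *-assoc 2 m (# (λ n → A (h + n)) x) ⟨
    2 * m * # (λ n → A (h + n)) x             ≤⟨ *-monoʳ-≤ (2 * m) (m≤n+m _ (# A h)) ⟩
    2 * m * (# A h + # (λ n → A (h + n)) x)   ≡⟨ cong (2 * m *_) (Σ<-split h x _) ⟨
    2 * m * # A (h + x)                       ≤⟨ small (h + x) (≤-trans (m≤m⊔n x₀ h) (≤-trans x≥ (m≤n+m x h))) ⟩
    h + x                                     ≤⟨ +-monoˡ-≤ x (≤-trans (m≤n⊔m x₀ h) x≥) ⟩
    x + x                                     ≡⟨ cong (x +_) (+-identityʳ x) ⟨
    2 * x                                     ∎)
    where open ≤-Reasoning

  -- Built as a finite union of shifts of one set, so that nullity follows from `null-∨` and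
  -- `null-shift`.
  changes : (ℕ → Sign) → ℕ → ℕ → Bool
  changes S zero    n = false
  changes S (suc h) n = changes S h n ∨ not (does (S (suc (h + n)) Sign.≟ S (h + n)))

  changes-null : ∀ S → Null (λ n → not (does (S (suc n) Sign.≟ S n))) → ∀ h → Null (changes S h)
  changes-null S null zero    = null-none
  changes-null S null (suc h) = null-∨ (changes-null S null h) (null-shift h null)

  unchanged : ∀ S H n → changes S H n ≡ false → ∀ h → h ≤ H → S (h + n) ≡ S n
  unchanged S H n ok zero h≤ = refl
  unchanged S (suc H) n ok (suc h) (s≤s h≤H) with m≤n⇒m<n∨m≡n h≤H
  ... | inj₁ h<H = unchanged S H n (∨-falseˡ (changes S H n) ok) (suc h) h<H
  ... | inj₂ refl = trans (not-does (S (suc (h + n)) Sign.≟ S (h + n)) (∨-falseʳ (changes S h n) ok))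
                         (unchanged S h n (∨-falseˡ (changes S h n) ok) h ≤-refl)

module Averages where

  open Construction
  open import Algebra.Properties.Group using (⁻¹-anti-homo-//)
  open import Data.Integer as ℤ using (ℤ; +_)
  import Data.Integer.Tactic.RingSolver as ℤ
  open import Data.Nat as ℕ using (ℕ; zero; suc; z≤n; s≤s; _%_)
  open import Data.Nat.DivMod using ([m+kn]%n≡m%n)
  open import Data.Nat.Primality using (Prime)
  import Data.Nat.Properties as ℕ
  open import Data.Nat.Tactic.RingSolver using (solve-∀)
  open import Data.Rational as ℚ using (ℚ; mkℚ; 0ℚ; 1ℚ; ½; _+_; _*_; _-_; -_; _≤_; _<_; ∣_∣; Positive; toℚᵘ)
  open import Data.Rational.Properties
  open import Data.Rational.Unnormalised as ℚᵘ using (mkℚᵘ; *≡*; *≤*)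
  import Data.Rational.Unnormalised.Properties as ℚᵘ

  -- Natural numbers inside the rationals

  ⟪_⟫ : ℕ → ℚ
  ⟪ zero ⟫  = 0ℚ
  ⟪ suc n ⟫ = ⟪ n ⟫ + 1ℚ

  0≤⟪_⟫ : ∀ n → 0ℚ ≤ ⟪ n ⟫
  0≤⟪ zero ⟫  = ≤-refl
  0≤⟪ suc n ⟫ = subst (_≤ ⟪ suc n ⟫) (+-identityˡ 0ℚ) (+-mono-≤ 0≤⟪ n ⟫ (nonNegative⁻¹ 1ℚ))

  ⟪⟫-+ : ∀ m n → ⟪ m ℕ.+ n ⟫ ≡ ⟪ m ⟫ + ⟪ n ⟫
  ⟪⟫-+ zero    n = sym (+-identityˡ ⟪ n ⟫)
  ⟪⟫-+ (suc m) n = begin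
    ⟪ m ℕ.+ n ⟫ + 1ℚ         ≡⟨ cong (_+ 1ℚ) (⟪⟫-+ m n) ⟩
    ⟪ m ⟫ + ⟪ n ⟫ + 1ℚ       ≡⟨ +-assoc ⟪ m ⟫ ⟪ n ⟫ 1ℚ ⟩
    ⟪ m ⟫ + (⟪ n ⟫ + 1ℚ)     ≡⟨ cong (λ z → ⟪ m ⟫ + z) (+-comm ⟪ n ⟫ 1ℚ) ⟩
    ⟪ m ⟫ + (1ℚ + ⟪ n ⟫)     ≡⟨ +-assoc ⟪ m ⟫ 1ℚ ⟪ n ⟫ ⟨
    ⟪ m ⟫ + 1ℚ + ⟪ n ⟫       ∎
    where open ≡-Reasoning

  ⟪⟫-* : ∀ m n → ⟪ m ℕ.* n ⟫ ≡ ⟪ m ⟫ * ⟪ n ⟫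
  ⟪⟫-* zero    n = sym (*-zeroˡ ⟪ n ⟫)
  ⟪⟫-* (suc m) n = begin
    ⟪ n ℕ.+ m ℕ.* n ⟫            ≡⟨ ⟪⟫-+ n (m ℕ.* n) ⟩
    ⟪ n ⟫ + ⟪ m ℕ.* n ⟫          ≡⟨ cong (λ z → ⟪ n ⟫ + z) (⟪⟫-* m n) ⟩
    ⟪ n ⟫ + ⟪ m ⟫ * ⟪ n ⟫        ≡⟨ +-comm ⟪ n ⟫ (⟪ m ⟫ * ⟪ n ⟫) ⟩
    ⟪ m ⟫ * ⟪ n ⟫ + ⟪ n ⟫        ≡⟨ cong (λ z → ⟪ m ⟫ * ⟪ n ⟫ + z) (*-identityˡ ⟪ n ⟫) ⟨
    ⟪ m ⟫ * ⟪ n ⟫ + 1ℚ * ⟪ n ⟫   ≡⟨ *-distribʳ-+ ⟪ n ⟫ ⟪ m ⟫ 1ℚ ⟨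
    (⟪ m ⟫ + 1ℚ) * ⟪ n ⟫         ∎
    where open ≡-Reasoning

  ⟪⟫-mono : ∀ {m n} → m ℕ.≤ n → ⟪ m ⟫ ≤ ⟪ n ⟫
  ⟪⟫-mono {n = n} z≤n = 0≤⟪ n ⟫
  ⟪⟫-mono (s≤s m≤n)   = +-monoˡ-≤ 1ℚ (⟪⟫-mono m≤n)

  toℚᵘ-⟪⟫ : ∀ n → toℚᵘ ⟪ n ⟫ ℚᵘ.≃ mkℚᵘ (+ n) 0
  toℚᵘ-⟪⟫ zero    = ℚᵘ.≃-refl
  toℚᵘ-⟪⟫ (suc n) = begin-equality
    toℚᵘ (⟪ n ⟫ + 1ℚ)             ≃⟨ toℚᵘ-homo-+ ⟪ n ⟫ 1ℚ ⟩
    toℚᵘ ⟪ n ⟫ ℚᵘ.+ toℚᵘ 1ℚ       ≃⟨ ℚᵘ.+-congˡ (toℚᵘ 1ℚ) (toℚᵘ-⟪⟫ n) ⟩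
    mkℚᵘ (+ n) 0 ℚᵘ.+ toℚᵘ 1ℚ     ≃⟨ *≡* (lemma (+ n)) ⟩
    mkℚᵘ (+ suc n) 0              ∎
    where
    open ℚᵘ.≤-Reasoning
    lemma : ∀ z → (z ℤ.* + 1 ℤ.+ + 1 ℤ.* + 1) ℤ.* + 1 ≡ (+ 1 ℤ.+ z) ℤ.* (+ 1 ℤ.* + 1)
    lemma = ℤ.solve-∀

  recip : ℕ → ℚ
  recip k = + 1 ℚ./ suc k

  ⟪⟫-recip : ∀ k → ⟪ suc k ⟫ * recip k ≡ 1ℚ
  ⟪⟫-recip k = toℚᵘ-injective (begin-equality
    toℚᵘ (⟪ suc k ⟫ * recip k)               ≃⟨ toℚᵘ-homo-* ⟪ suc k ⟫ (recip k) ⟩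
    toℚᵘ ⟪ suc k ⟫ ℚᵘ.* toℚᵘ (recip k)       ≃⟨ ℚᵘ.*-cong (toℚᵘ-⟪⟫ (suc k)) (toℚᵘ-fromℚᵘ (mkℚᵘ (+ 1) k)) ⟩
    mkℚᵘ (+ suc k) 0 ℚᵘ.* mkℚᵘ (+ 1) k       ≃⟨ *≡* (lemma (+ suc k)) ⟩
    toℚᵘ 1ℚ                                  ∎)
    where
    open ℚᵘ.≤-Reasoning
    lemma : ∀ z → z ℤ.* + 1 ℤ.* + 1 ≡ + 1 ℤ.* (+ 1 ℤ.* z)
    lemma = ℤ.solve-∀

  0<recip : ∀ k → 0ℚ < recip k
  0<recip k = positive⁻¹ (recip k) {{normalize-pos 1 (suc k)}}

  recip-pos : ∀ k → Positive (recip k)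
  recip-pos k = ℚ.positive (0<recip k)

  -- ε = a / b with a ≥ 1 satisfies ε b ≥ 1.
  archimedean : ∀ {ε} → 0ℚ < ε → ∃ λ m → 1ℚ ≤ ε * ⟪ suc m ⟫
  archimedean {mkℚ (+ zero) d _} 0<ε with () ← ℤ.Positive.pos (ℚ.positive 0<ε)
  archimedean {mkℚ (ℤ.-[1+ a ]) d _} 0<ε with () ← ℤ.Positive.pos (ℚ.positive 0<ε)
  archimedean {ε@(mkℚ (+ suc a) d _)} 0<ε = d , toℚᵘ-cancel-≤ (begin
    toℚᵘ 1ℚ
      ≤⟨ *≤* (ℤ.+≤+ (subst₂ ℕ._≤_ (lemma₁ d) (lemma₂ a d) (ℕ.m≤m+n (suc d) (a ℕ.* suc d)))) ⟩
    mkℚᵘ (+ suc a) d ℚᵘ.* mkℚᵘ (+ suc d) 0     ≃⟨ ℚᵘ.*-congˡ {toℚᵘ ε} (toℚᵘ-⟪⟫ (suc d)) ⟨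
    toℚᵘ ε ℚᵘ.* toℚᵘ ⟪ suc d ⟫                 ≃⟨ toℚᵘ-homo-* ε ⟪ suc d ⟫ ⟨
    toℚᵘ (ε * ⟪ suc d ⟫)                       ∎)
    where
    open ℚᵘ.≤-Reasoning
    lemma₁ : ∀ d → 1 ℕ.+ d ≡ 1 ℕ.* ((1 ℕ.+ d) ℕ.* 1)
    lemma₁ = solve-∀
    lemma₂ : ∀ a d → 1 ℕ.+ d ℕ.+ a ℕ.* (1 ℕ.+ d) ≡ (1 ℕ.+ a) ℕ.* (1 ℕ.+ d) ℕ.* 1
    lemma₂ = solve-∀

  -- Sums, averages and their limits

  sumTo-cong : ∀ x {g h : ℕ → ℚ} → (∀ n → n ℕ.≤ x → g n ≡ h n) → sumTo x g ≡ sumTo x h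
  sumTo-cong zero    eq = refl
  sumTo-cong (suc x) eq = cong₂ _+_ (sumTo-cong x λ n n≤x → eq n (ℕ.m≤n⇒m≤1+n n≤x)) (eq (suc x) ℕ.≤-refl)

  +-interchange : ∀ a b c d → (a + b) + (c + d) ≡ (a + c) + (b + d)
  +-interchange a b c d = begin
    (a + b) + (c + d)     ≡⟨ +-assoc a b (c + d) ⟩
    a + (b + (c + d))     ≡⟨ cong (λ z → a + z) (+-assoc b c d) ⟨
    a + (b + c + d)       ≡⟨ cong (λ z → a + (z + d)) (+-comm b c) ⟩
    a + (c + b + d)       ≡⟨ cong (λ z → a + z) (+-assoc c b d) ⟩
    a + (c + (b + d))     ≡⟨ +-assoc a c (b + d) ⟨
    (a + c) + (b + d)     ∎
    where open ≡-Reasoning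

  sumTo-+ : ∀ x (g h : ℕ → ℚ) → sumTo x (λ n → g n + h n) ≡ sumTo x g + sumTo x h
  sumTo-+ zero    g h = sym (+-identityˡ 0ℚ)
  sumTo-+ (suc x) g h = trans (cong (_+ (g (suc x) + h (suc x))) (sumTo-+ x g h))
                              (+-interchange (sumTo x g) (sumTo x h) (g (suc x)) (h (suc x)))

  sumTo-*ˡ : ∀ x c (g : ℕ → ℚ) → sumTo x (λ n → c * g n) ≡ c * sumTo x g
  sumTo-*ˡ zero    c g = sym (*-zeroʳ c)
  sumTo-*ˡ (suc x) c g = trans (cong (_+ c * g (suc x)) (sumTo-*ˡ x c g)) (sym (*-distribˡ-+ c (sumTo x g) (g (suc x))))

  sumTo-const : ∀ x c → sumTo x (λ _ → c) ≡ ⟪ x ⟫ * c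
  sumTo-const zero    c = sym (*-zeroˡ c)
  sumTo-const (suc x) c = trans (cong₂ _+_ (sumTo-const x c) (sym (*-identityˡ c))) (sym (*-distribʳ-+ c ⟪ x ⟫ 1ℚ))

  sumTo-mono : ∀ x {g h : ℕ → ℚ} → (∀ n → g (suc n) ≤ h (suc n)) → sumTo x g ≤ sumTo x h
  sumTo-mono zero    le = ≤-refl
  sumTo-mono (suc x) le = +-mono-≤ (sumTo-mono x le) (le x)

  ∣sumTo∣≤ : ∀ x (g : ℕ → ℚ) → ∣ sumTo x g ∣ ≤ sumTo x (λ n → ∣ g n ∣)
  ∣sumTo∣≤ zero    g = ≤-refl
  ∣sumTo∣≤ (suc x) g = ≤-trans (∣p+q∣≤∣p∣+∣q∣ (sumTo x g) (g (suc x))) (+-monoˡ-≤ ∣ g (suc x) ∣ (∣sumTo∣≤ x g))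

  -- The sum runs over 1, ..., x and the count over 0, ..., x; hence `suc x`, and an inequality
  -- instead of an equation.
  sumTo-𝟙 : ∀ x A → sumTo x (λ n → 𝟙 (A n)) ≤ ⟪ # A (suc x) ⟫
  sumTo-𝟙 zero    A = 0≤⟪ # A 1 ⟫
  sumTo-𝟙 (suc x) A = ≤-trans (+-mono-≤ (sumTo-𝟙 x A) (𝟙≤ (A (suc x))))
    (≤-reflexive (sym (⟪⟫-+ (# A (suc x)) (𝕀 (A (suc x))))))
    where
    𝟙≤ : ∀ b → 𝟙 b ≤ ⟪ 𝕀 b ⟫
    𝟙≤ true  = ≤-refl
    𝟙≤ false = ≤-refl

  avg-cong : ∀ x {g h : ℕ → ℚ} → (∀ n → n ℕ.≤ x → g n ≡ h n) → avg x g ≡ avg x h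
  avg-cong zero    eq = refl
  avg-cong (suc k) eq = cong (_* recip k) (sumTo-cong (suc k) eq)

  avg-+ : ∀ x (g h : ℕ → ℚ) → avg x (λ n → g n + h n) ≡ avg x g + avg x h
  avg-+ zero    g h = refl
  avg-+ (suc k) g h = trans (cong (_* recip k) (sumTo-+ (suc k) g h)) (*-distribʳ-+ (recip k) (sumTo (suc k) g) (sumTo (suc k) h))

  avg-*ˡ : ∀ x c (g : ℕ → ℚ) → avg x (λ n → c * g n) ≡ c * avg x g
  avg-*ˡ zero    c g = sym (*-zeroʳ c)
  avg-*ˡ (suc k) c g = trans (cong (_* recip k) (sumTo-*ˡ (suc k) c g)) (*-assoc c (sumTo (suc k) g) (recip k))

  avg-const : ∀ k c → avg (suc k) (λ _ → c) ≡ c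
  avg-const k c = begin
    sumTo (suc k) (λ _ → c) * recip k   ≡⟨ cong (_* recip k) (trans (sumTo-const (suc k) c) (*-comm ⟪ suc k ⟫ c)) ⟩
    c * ⟪ suc k ⟫ * recip k             ≡⟨ *-assoc c ⟪ suc k ⟫ (recip k) ⟩
    c * (⟪ suc k ⟫ * recip k)           ≡⟨ cong (c *_) (⟪⟫-recip k) ⟩
    c * 1ℚ                              ≡⟨ *-identityʳ c ⟩
    c                                   ∎
    where open ≡-Reasoning

  avg-mono : ∀ k {g h : ℕ → ℚ} → (∀ n → g n ≤ h n) → avg (suc k) g ≤ avg (suc k) h
  avg-mono k le = *-monoʳ-≤-nonNeg (recip k) {{pos⇒nonNeg (recip k) {{recip-pos k}}}} (sumTo-mono (suc k) λ n → le (suc n))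

  ∣avg∣≤1 : ∀ k {g : ℕ → ℚ} → (∀ n → ∣ g n ∣ ≤ 1ℚ) → ∣ avg (suc k) g ∣ ≤ 1ℚ
  ∣avg∣≤1 k {g} le = begin
    ∣ sumTo (suc k) g * recip k ∣            ≡⟨ ∣p*q∣≡∣p∣*∣q∣ (sumTo (suc k) g) (recip k) ⟩
    ∣ sumTo (suc k) g ∣ * ∣ recip k ∣        ≡⟨ cong (∣ sumTo (suc k) g ∣ *_) (0≤p⇒∣p∣≡p (<⇒≤ (0<recip k))) ⟩
    ∣ sumTo (suc k) g ∣ * recip k            ≤⟨ *-monoʳ-≤-nonNeg (recip k) {{pos⇒nonNeg (recip k) {{recip-pos k}}}} (∣sumTo∣≤ (suc k) g) ⟩
    avg (suc k) (λ n → ∣ g n ∣)              ≤⟨ avg-mono k le ⟩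
    avg (suc k) (λ _ → 1ℚ)                   ≡⟨ avg-const k 1ℚ ⟩
    1ℚ                                       ∎
    where open ≤-Reasoning

  -- Clears the denominators, so that smallness of an average reduces to comparing two natural
  -- numbers.
  small-average : ∀ k {ε} s m → 1ℚ ≤ ε * ⟪ suc m ⟫ → ∣ s ∣ * ⟪ suc m ⟫ < ⟪ suc k ⟫ → ∣ s * recip k ∣ < ε
  small-average k {ε} s m 1≤ lt = begin-strict
    ∣ s * recip k ∣              ≡⟨ ∣p*q∣≡∣p∣*∣q∣ s (recip k) ⟩
    ∣ s ∣ * ∣ recip k ∣          ≡⟨ cong (∣ s ∣ *_) (0≤p⇒∣p∣≡p (<⇒≤ (0<recip k))) ⟩
    ∣ s ∣ * recip k              <⟨ *-monoˡ-<-pos (recip k) {{recip-pos k}} s<εx ⟩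
    ε * ⟪ suc k ⟫ * recip k      ≡⟨ *-assoc ε ⟪ suc k ⟫ (recip k) ⟩
    ε * (⟪ suc k ⟫ * recip k)    ≡⟨ cong (ε *_) (⟪⟫-recip k) ⟩
    ε * 1ℚ                       ≡⟨ *-identityʳ ε ⟩
    ε                            ∎
    where
    open ≤-Reasoning
    s<εx : ∣ s ∣ < ε * ⟪ suc k ⟫
    s<εx = *-cancelʳ-<-nonNeg ⟪ suc m ⟫ {{ℚ.nonNegative 0≤⟪ suc m ⟫}} (begin-strict
      ∣ s ∣ * ⟪ suc m ⟫              <⟨ lt ⟩
      ⟪ suc k ⟫                      ≡⟨ *-identityˡ ⟪ suc k ⟫ ⟨
      1ℚ * ⟪ suc k ⟫                 ≤⟨ *-monoʳ-≤-nonNeg ⟪ suc k ⟫ {{ℚ.nonNegative 0≤⟪ suc k ⟫}} 1≤ ⟩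
      ε * ⟪ suc m ⟫ * ⟪ suc k ⟫      ≡⟨ *-assoc ε ⟪ suc m ⟫ ⟪ suc k ⟫ ⟩
      ε * (⟪ suc m ⟫ * ⟪ suc k ⟫)    ≡⟨ cong (ε *_) (*-comm ⟪ suc m ⟫ ⟪ suc k ⟫) ⟩
      ε * (⟪ suc k ⟫ * ⟪ suc m ⟫)    ≡⟨ *-assoc ε ⟪ suc k ⟫ ⟪ suc m ⟫ ⟨
      ε * ⟪ suc k ⟫ * ⟪ suc m ⟫      ∎)

  telescope : ∀ a b c → a - c ≡ (a - b) + (b - c)
  telescope a b c = begin
    a - c                     ≡⟨ cong (_- c) (+-identityʳ a) ⟨
    a + 0ℚ - c                ≡⟨ cong (λ z → a + z - c) (+-inverseˡ b) ⟨
    a + (- b + b) - c         ≡⟨ cong (_- c) (+-assoc a (- b) b) ⟨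
    a - b + b - c             ≡⟨ +-assoc (a - b) b (- c) ⟩
    (a - b) + (b - c)         ∎
    where open ≡-Reasoning

  -- The common source of all limits below: `g` is compared with a model `h`, and the total
  -- deviation is at most twice a null count plus a constant, hence o(x).
  average-limit : ∀ (g h : ℕ → ℚ) L A → Null A → (∀ n → ∣ g (suc n) - h (suc n) ∣ ≤ ⟪ 2 ⟫ * 𝟙 (A (suc n))) →
                  ∀ K → (∀ x → ∣ sumTo x (λ n → h n - L) ∣ ≤ ⟪ K ⟫) → ConvergesTo (λ x → avg x g) L
  average-limit g h L A null close K bounded ε 0<ε with archimedean 0<ε
  -- The factor 8 leaves about a quarter of `x` for the term with the null set, and the summand
  -- `2 * (suc m * K)` of the threshold leaves half of it for `K`.
  ... | m , 1≤ with null (8 ℕ.* suc m)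
  ...   | x₀ , rare = suc (x₀ ℕ.+ 2 ℕ.* (suc m ℕ.* K)) , λ { (suc k) (s≤s k≥) →
          subst (λ z → ∣ z ∣ < ε) (sym (centre k)) (small-average k (sumTo (suc k) (λ n → g n - L)) m 1≤ (total k k≥)) }
    where
    centre : ∀ k → avg (suc k) g - L ≡ sumTo (suc k) (λ n → g n - L) * recip k
    centre k = sym (trans (avg-+ (suc k) g (λ _ → - L)) (cong (λ z → avg (suc k) g + z) (avg-const k (- L))))

    sum-bound : ∀ x → ∣ sumTo x (λ n → g n - L) ∣ ≤ ⟪ 2 ℕ.* # A (suc x) ℕ.+ K ⟫
    sum-bound x = begin
      ∣ sumTo x (λ n → g n - L) ∣
        ≡⟨ cong ∣_∣ (trans (sumTo-cong x λ n _ → telescope (g n) (h n) L) (sumTo-+ x _ _)) ⟩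
      ∣ sumTo x (λ n → g n - h n) + sumTo x (λ n → h n - L) ∣
        ≤⟨ ∣p+q∣≤∣p∣+∣q∣ (sumTo x (λ n → g n - h n)) (sumTo x (λ n → h n - L)) ⟩
      ∣ sumTo x (λ n → g n - h n) ∣ + ∣ sumTo x (λ n → h n - L) ∣
        ≤⟨ +-mono-≤ (≤-trans (∣sumTo∣≤ x (λ n → g n - h n)) (sumTo-mono x close)) (bounded x) ⟩
      sumTo x (λ n → ⟪ 2 ⟫ * 𝟙 (A n)) + ⟪ K ⟫
        ≡⟨ cong (_+ ⟪ K ⟫) (sumTo-*ˡ x ⟪ 2 ⟫ (λ n → 𝟙 (A n))) ⟩
      ⟪ 2 ⟫ * sumTo x (λ n → 𝟙 (A n)) + ⟪ K ⟫
        ≤⟨ +-monoˡ-≤ ⟪ K ⟫ (*-monoˡ-≤-nonNeg ⟪ 2 ⟫ {{ℚ.nonNegative 0≤⟪ 2 ⟫}} (sumTo-𝟙 x A)) ⟩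
      ⟪ 2 ⟫ * ⟪ # A (suc x) ⟫ + ⟪ K ⟫
        ≡⟨ trans (⟪⟫-+ (2 ℕ.* # A (suc x)) K) (cong (_+ ⟪ K ⟫) (⟪⟫-* 2 (# A (suc x)))) ⟨
      ⟪ 2 ℕ.* # A (suc x) ℕ.+ K ⟫ ∎
      where open ≤-Reasoning

    count-bound : ∀ k → x₀ ℕ.+ 2 ℕ.* (suc m ℕ.* K) ℕ.≤ k → (2 ℕ.* # A (suc (suc k)) ℕ.+ K) ℕ.* suc m ℕ.< suc k
    count-bound k k≥ = ℕ.*-cancelˡ-< 4 _ _ (begin-strict
      4 ℕ.* ((2 ℕ.* a ℕ.+ K) ℕ.* suc m)                    ≡⟨ expand a K (suc m) ⟩
      8 ℕ.* suc m ℕ.* a ℕ.+ 2 ℕ.* (2 ℕ.* (suc m ℕ.* K))    ≤⟨ ℕ.+-mono-≤ (rare (suc (suc k)) (ℕ.≤-trans (ℕ.m≤m+n x₀ _) (ℕ.≤-trans k≥ (ℕ.m≤n+m k 2))))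
                                                                (ℕ.*-monoʳ-≤ 2 (ℕ.≤-trans (ℕ.m≤n+m _ x₀) k≥)) ⟩
      2 ℕ.+ k ℕ.+ 2 ℕ.* k                                  <⟨ ℕ.m<m+n _ ℕ.z<s ⟩
      2 ℕ.+ k ℕ.+ 2 ℕ.* k ℕ.+ (2 ℕ.+ k)                    ≡⟨ collect k ⟩
      4 ℕ.* suc k                                          ∎)
      where
      open ℕ.≤-Reasoning
      a = # A (suc (suc k))
      expand : ∀ a K m → 4 ℕ.* ((2 ℕ.* a ℕ.+ K) ℕ.* m) ≡ 8 ℕ.* m ℕ.* a ℕ.+ 2 ℕ.* (2 ℕ.* (m ℕ.* K))
      expand = solve-∀
      collect : ∀ k → 2 ℕ.+ k ℕ.+ 2 ℕ.* k ℕ.+ (2 ℕ.+ k) ≡ 4 ℕ.* (1 ℕ.+ k)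
      collect = solve-∀

    ⟪⟫-mono-< : ∀ {a b} → a ℕ.< b → ⟪ a ⟫ < ⟪ b ⟫
    ⟪⟫-mono-< {a} a<b = <-≤-trans (subst (_< ⟪ suc a ⟫) (+-identityʳ ⟪ a ⟫) (+-monoʳ-< ⟪ a ⟫ (positive⁻¹ 1ℚ))) (⟪⟫-mono a<b)

    total : ∀ k → x₀ ℕ.+ 2 ℕ.* (suc m ℕ.* K) ℕ.≤ k → ∣ sumTo (suc k) (λ n → g n - L) ∣ * ⟪ suc m ⟫ < ⟪ suc k ⟫
    total k k≥ = begin-strict
      ∣ sumTo (suc k) (λ n → g n - L) ∣ * ⟪ suc m ⟫
        ≤⟨ *-monoʳ-≤-nonNeg ⟪ suc m ⟫ {{ℚ.nonNegative 0≤⟪ suc m ⟫}} (sum-bound (suc k)) ⟩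
      ⟪ 2 ℕ.* # A (suc (suc k)) ℕ.+ K ⟫ * ⟪ suc m ⟫            ≡⟨ ⟪⟫-* (2 ℕ.* # A (suc (suc k)) ℕ.+ K) (suc m) ⟨
      ⟪ (2 ℕ.* # A (suc (suc k)) ℕ.+ K) ℕ.* suc m ⟫            <⟨ ⟪⟫-mono-< (count-bound k k≥) ⟩
      ⟪ suc k ⟫                                                ∎
      where open ≤-Reasoning

  -- Complete blocks of three cancel, and at most two terms of size 2 remain.
  block-sums-bounded : ∀ (g : ℕ → ℚ) → (∀ j → g (1 ℕ.+ j ℕ.* 3) + g (2 ℕ.+ j ℕ.* 3) + g (3 ℕ.+ j ℕ.* 3) ≡ 0ℚ) →
                       (∀ n → ∣ g n ∣ ≤ ⟪ 2 ⟫) → ∀ x → ∣ sumTo x g ∣ ≤ ⟪ 4 ⟫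
  block-sums-bounded g zero-sum le x = subst (λ z → ∣ sumTo z g ∣ ≤ ⟪ 4 ⟫)
    (sym (trans (divMod x (s≤s z≤n)) (ℕ.+-comm (x ÷ 3 ℕ.* 3) (x mod 3))))
    (partial (x ÷ 3) (x mod 3) (mod-< x (s≤s z≤n)))
    where
    full : ∀ j → sumTo (j ℕ.* 3) g ≡ 0ℚ
    full zero    = refl
    full (suc j) = begin
      sumTo (j ℕ.* 3) g + a + b + c       ≡⟨ cong (λ z → z + a + b + c) (full j) ⟩
      0ℚ + a + b + c                      ≡⟨ cong (λ z → z + b + c) (+-identityˡ a) ⟩
      a + b + c                           ≡⟨ zero-sum j ⟩
      0ℚ                                  ∎
      where
      open ≡-Reasoning
      a = g (1 ℕ.+ j ℕ.* 3)
      b = g (2 ℕ.+ j ℕ.* 3)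
      c = g (3 ℕ.+ j ℕ.* 3)
    partial : ∀ j r → r ℕ.< 3 → ∣ sumTo (r ℕ.+ j ℕ.* 3) g ∣ ≤ ⟪ 4 ⟫
    partial j 0 _ = subst (λ z → ∣ z ∣ ≤ ⟪ 4 ⟫) (sym (full j)) 0≤⟪ 4 ⟫
    partial j 1 _ = subst (λ z → ∣ z ∣ ≤ ⟪ 4 ⟫) (sym (trans (cong (_+ g (1 ℕ.+ j ℕ.* 3)) (full j)) (+-identityˡ (g (1 ℕ.+ j ℕ.* 3)))))
      (≤-trans (le (1 ℕ.+ j ℕ.* 3)) (⟪⟫-mono {2} {4} (s≤s (s≤s z≤n))))
    partial j 2 _ = subst (λ z → ∣ z + g (2 ℕ.+ j ℕ.* 3) ∣ ≤ ⟪ 4 ⟫)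
      (sym (trans (cong (_+ g (1 ℕ.+ j ℕ.* 3)) (full j)) (+-identityˡ (g (1 ℕ.+ j ℕ.* 3)))))
      (≤-trans (∣p+q∣≤∣p∣+∣q∣ (g (1 ℕ.+ j ℕ.* 3)) (g (2 ℕ.+ j ℕ.* 3))) (+-mono-≤ (le (1 ℕ.+ j ℕ.* 3)) (le (2 ℕ.+ j ℕ.* 3))))
    partial j (suc (suc (suc _))) (s≤s (s≤s (s≤s ())))

  close-off : ∀ b q → ∣ q ∣ ≤ ⟪ 2 ⟫ → (b ≡ false → q ≡ 0ℚ) → ∣ q ∣ ≤ ⟪ 2 ⟫ * 𝟙 b
  close-off true  q le _  = ≤-trans le (≤-reflexive (sym (*-identityʳ ⟪ 2 ⟫)))
  close-off false q le eq rewrite eq refl = ≤-reflexive (sym (*-zeroʳ ⟪ 2 ⟫))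

  convergent⇒Cauchy : ∀ a L → ConvergesTo a L → Cauchy a
  convergent⇒Cauchy a L conv ε 0<ε with conv (ε * ½) (subst (_< ε * ½) (*-zeroˡ ½) (*-monoˡ-<-pos ½ 0<ε))
  ... | X , close = X , λ x y x≥X y≥X → begin-strict
    ∣ a x - a y ∣                     ≡⟨ cong ∣_∣ (telescope (a x) L (a y)) ⟩
    ∣ (a x - L) + (L - a y) ∣         ≤⟨ ∣p+q∣≤∣p∣+∣q∣ (a x - L) (L - a y) ⟩
    ∣ a x - L ∣ + ∣ L - a y ∣         ≡⟨ cong (λ z → ∣ a x - L ∣ + z) (flip (a y)) ⟩
    ∣ a x - L ∣ + ∣ a y - L ∣         <⟨ +-mono-< (close x x≥X) (close y y≥X) ⟩
    ε * ½ + ε * ½                     ≡⟨ *-distribˡ-+ ε ½ ½ ⟨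
    ε * 1ℚ                            ≡⟨ *-identityʳ ε ⟩
    ε                                 ∎
    where
    open ≤-Reasoning
    flip : ∀ q → ∣ L - q ∣ ≡ ∣ q - L ∣
    flip q = trans (sym (∣-p∣≡∣p∣ (L - q))) (cong ∣_∣ (⁻¹-anti-homo-// +-0-group L q))

  ∣p-q∣≤2 : ∀ p q → ∣ p ∣ ≤ 1ℚ → ∣ q ∣ ≤ 1ℚ → ∣ p - q ∣ ≤ ⟪ 2 ⟫
  ∣p-q∣≤2 p q p≤ q≤ = ≤-trans (∣p-q∣≤∣p∣+∣q∣ p q) (+-mono-≤ p≤ q≤)

  ∣⟦_⟧∣≡1 : ∀ s → ∣ ⟦ s ⟧ ∣ ≡ 1ℚ
  ∣⟦ Sign.+ ⟧∣≡1 = refl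
  ∣⟦ Sign.- ⟧∣≡1 = refl

  ⟦⟧-* : ∀ s t → ⟦ s ⟧ * ⟦ t ⟧ ≡ ⟦ s Sign.* t ⟧
  ⟦⟧-* Sign.+ t      = *-identityˡ ⟦ t ⟧
  ⟦⟧-* Sign.- Sign.+ = refl
  ⟦⟧-* Sign.- Sign.- = refl

  ∣⟦⟧*⟦⟧∣≤1 : ∀ s t → ∣ ⟦ s ⟧ * ⟦ t ⟧ ∣ ≤ 1ℚ
  ∣⟦⟧*⟦⟧∣≤1 s t = ≤-reflexive (trans (cong ∣_∣ (⟦⟧-* s t)) ∣⟦ s Sign.* t ⟧∣≡1)

  centred-block : ∀ L {C} a b c → a + b + c ≡ C → C + (- L + - L + - L) ≡ 0ℚ → (a - L) + (b - L) + (c - L) ≡ 0ℚ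
  centred-block L {C} a b c sum zero-sum = begin
    (a - L) + (b - L) + (c - L)             ≡⟨ cong (_+ (c - L)) (+-interchange a (- L) b (- L)) ⟩
    (a + b) + (- L + - L) + (c - L)         ≡⟨ +-interchange (a + b) (- L + - L) c (- L) ⟩
    (a + b + c) + (- L + - L + - L)         ≡⟨ cong (_+ (- L + - L + - L)) sum ⟩
    C + (- L + - L + - L)                   ≡⟨ zero-sum ⟩
    0ℚ                                      ∎
    where open ≡-Reasoning

  -- The function f and its three properties

  open Tower ψ using (S; S-suc; S-*)

  ⅓ : ℚ
  ⅓ = + 1 ℚ./ 3

  f : ℕ → Sign
  f n = κ n Sign.* S n

  differs : ℕ → Bool
  differs n = not (does (S (suc n) Sign.≟ S n))

  f-dilate : ∀ {p} → Prime p → Density0 (badSet f p)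
  f-dilate {p} pp = average-limit (λ n → 𝟙 (badSet f p n)) (λ _ → 0ℚ) 0ℚ A (S-* pp (ψ-prime-* pp))
    (λ n → close-off (A (suc n)) (𝟙 (badSet f p (suc n)) - 0ℚ)
        (∣p-q∣≤2 (𝟙 (badSet f p (suc n))) 0ℚ (∣𝟙∣≤1 (badSet f p (suc n))) 0≤⟪ 1 ⟫)
        λ ok → cong (λ b → 𝟙 b - 0ℚ) (good n ok))
    0 (λ x → ≤-reflexive (cong ∣_∣ (trans (sumTo-const x 0ℚ) (*-zeroʳ ⟪ x ⟫))))
    where
    A : ℕ → Bool
    A n = not (does (S (p ℕ.* n) Sign.≟ ψ p Sign.* S n))
    ∣𝟙∣≤1 : ∀ b → ∣ 𝟙 b ∣ ≤ 1ℚ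
    ∣𝟙∣≤1 true  = ≤-refl
    ∣𝟙∣≤1 false = 0≤⟪ 1 ⟫
    -- Here `x` is `χ₃ p`: dilation multiplies `κ` by it and `S` by its opposite, so the product of
    -- the two factors is always -.
    signs : ∀ x k s → k Sign.* s ≡ Sign.opposite ((x Sign.* k) Sign.* (Sign.opposite x Sign.* s))
    signs Sign.+ Sign.+ Sign.+ = refl
    signs Sign.+ Sign.+ Sign.- = refl
    signs Sign.+ Sign.- Sign.+ = refl
    signs Sign.+ Sign.- Sign.- = refl
    signs Sign.- Sign.+ Sign.+ = refl
    signs Sign.- Sign.+ Sign.- = refl
    signs Sign.- Sign.- Sign.+ = refl
    signs Sign.- Sign.- Sign.- = refl
    good : ∀ n → A (suc n) ≡ false → badSet f p (suc n) ≡ false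
    good n ok = cong (λ b → if b then false else true) (dec-true (f (suc n) Sign.≟ Sign.opposite (f (p ℕ.* suc n)))
      (trans (signs (χ₃ p) (κ (suc n)) (S (suc n))) (cong Sign.opposite (sym (cong₂ Sign._*_
        (extend-prime-* χ₃ pp ℕ.z<s)
        (trans (not-does (S (p ℕ.* suc n) Sign.≟ ψ p Sign.* S (suc n)) ok)
               (cong (Sign._* S (suc n)) (extend-prime _ pp))))))))

  f-correlation : ConvergesTo (λ x → avg x (λ n → ⟦ f n ⟧ * ⟦ f (n ℕ.+ 1) ⟧)) (- ⅓)
  f-correlation = average-limit g h (- ⅓) differs S-suc
    (λ n → close-off (differs (suc n)) (g (suc n) - h (suc n))
      (∣p-q∣≤2 (g (suc n)) (h (suc n))
        (∣⟦⟧*⟦⟧∣≤1 (f (suc n)) (f (suc n ℕ.+ 1))) (∣⟦⟧*⟦⟧∣≤1 (κ (suc n)) (κ (suc (suc n)))))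
      λ ok → trans (cong (λ z → z - h (suc n)) (equal (suc n) ok)) (+-inverseʳ (h (suc n))))
    4 (block-sums-bounded (λ n → h n - - ⅓)
        (λ j → centred-block (- ⅓) (h (1 ℕ.+ j ℕ.* 3)) (h (2 ℕ.+ j ℕ.* 3)) (h (3 ℕ.+ j ℕ.* 3)) (block j) refl)
        λ n → ∣p-q∣≤2 (h n) (- ⅓) (∣⟦⟧*⟦⟧∣≤1 (κ n) (κ (suc n))) (≤ᵇ⇒≤ {∣ - ⅓ ∣} {1ℚ} _))
    where
    g h : ℕ → ℚ
    g n = ⟦ f n ⟧ * ⟦ f (n ℕ.+ 1) ⟧
    h n = ⟦ κ n ⟧ * ⟦ κ (suc n) ⟧
    cancel : ∀ k l s → ⟦ k Sign.* s ⟧ * ⟦ l Sign.* s ⟧ ≡ ⟦ k ⟧ * ⟦ l ⟧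
    cancel Sign.+ Sign.+ Sign.+ = refl
    cancel Sign.+ Sign.+ Sign.- = refl
    cancel Sign.+ Sign.- Sign.+ = refl
    cancel Sign.+ Sign.- Sign.- = refl
    cancel Sign.- Sign.+ Sign.+ = refl
    cancel Sign.- Sign.+ Sign.- = refl
    cancel Sign.- Sign.- Sign.+ = refl
    cancel Sign.- Sign.- Sign.- = refl
    equal : ∀ n → differs n ≡ false → ⟦ f n ⟧ * ⟦ f (n ℕ.+ 1) ⟧ ≡ h n
    equal n ok = begin
      ⟦ f n ⟧ * ⟦ f (n ℕ.+ 1) ⟧                            ≡⟨ cong (λ z → ⟦ f n ⟧ * ⟦ f z ⟧) (ℕ.+-comm n 1) ⟩
      ⟦ f n ⟧ * ⟦ κ (suc n) Sign.* S (suc n) ⟧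
        ≡⟨ cong (λ s → ⟦ f n ⟧ * ⟦ κ (suc n) Sign.* s ⟧) (not-does (S (suc n) Sign.≟ S n) ok) ⟩
      ⟦ κ n Sign.* S n ⟧ * ⟦ κ (suc n) Sign.* S n ⟧        ≡⟨ cancel (κ n) (κ (suc n)) (S n) ⟩
      h n                                                  ∎
      where open ≡-Reasoning
    -- At 1, 2, 3, 4 mod 3, κ takes the values +, −, k, + for some k, and (−1) + (−k) + k = −1.
    block : ∀ j → h (1 ℕ.+ j ℕ.* 3) + h (2 ℕ.+ j ℕ.* 3) + h (3 ℕ.+ j ℕ.* 3) ≡ - 1ℚ
    block j rewrite κ-1mod3 (1 ℕ.+ j ℕ.* 3) ([m+kn]%n≡m%n 1 j 3)
                  | κ-2mod3 (2 ℕ.+ j ℕ.* 3) ([m+kn]%n≡m%n 2 j 3)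
                  | κ-1mod3 (4 ℕ.+ j ℕ.* 3) ([m+kn]%n≡m%n 4 j 3) with κ (3 ℕ.+ j ℕ.* 3)
    ... | Sign.+ = refl
    ... | Sign.- = refl

  w : ℕ → ℚ
  w m = 𝟙 (does (m % 3 ℕ.≟ 1))

  0≤w : ∀ m → 0ℚ ≤ w m
  0≤w m with does (m % 3 ℕ.≟ 1)
  ... | true  = 0≤⟪ 1 ⟫
  ... | false = ≤-refl

  w≤1 : ∀ m → ∣ w m ∣ ≤ 1ℚ
  w≤1 m with does (m % 3 ℕ.≟ 1)
  ... | true  = ≤-refl
  ... | false = 0≤⟪ 1 ⟫

  w-sum : ∀ m → w m + w (1 ℕ.+ m) + w (2 ℕ.+ m) ≡ 1ℚ
  w-sum m = subst (λ m → w m + w (1 ℕ.+ m) + w (2 ℕ.+ m) ≡ 1ℚ) (sym (trans (divMod m (s≤s z≤n)) (ℕ.+-comm (m ÷ 3 ℕ.* 3) (m mod 3))))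
    (residues (m mod 3) (mod-< m (s≤s z≤n)))
    where
    q = m ÷ 3
    w-+ : ∀ r → w (r ℕ.+ q ℕ.* 3) ≡ w r
    w-+ r = cong (λ z → 𝟙 (does (z ℕ.≟ 1))) ([m+kn]%n≡m%n r q 3)
    three : ∀ r → w r + w (1 ℕ.+ r) + w (2 ℕ.+ r) ≡ 1ℚ →
            w (r ℕ.+ q ℕ.* 3) + w (1 ℕ.+ (r ℕ.+ q ℕ.* 3)) + w (2 ℕ.+ (r ℕ.+ q ℕ.* 3)) ≡ 1ℚ
    three r eq = trans (cong₂ _+_ (cong₂ _+_ (w-+ r) (w-+ (1 ℕ.+ r))) (w-+ (2 ℕ.+ r))) eq
    residues : ∀ r → r ℕ.< 3 → w (r ℕ.+ q ℕ.* 3) + w (1 ℕ.+ (r ℕ.+ q ℕ.* 3)) + w (2 ℕ.+ (r ℕ.+ q ℕ.* 3)) ≡ 1ℚ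
    residues 0 _ = three 0 refl
    residues 1 _ = three 1 refl
    residues 2 _ = three 2 refl
    residues (suc (suc (suc _))) (s≤s (s≤s (s≤s ())))

  f₃≡ : ∀ m → f₃ f m ≡ ⟦ S m ⟧ * w m
  f₃≡ m = split (m % 3 ℕ.≟ 1)
    where
    split : (d : Dec (m % 3 ≡ 1)) → (if does d then ⟦ f m ⟧ else 0ℚ) ≡ ⟦ S m ⟧ * 𝟙 (does d)
    split (yes eq) = trans (cong (λ s → ⟦ s Sign.* S m ⟧) (κ-1mod3 m eq)) (sym (*-identityʳ ⟦ S m ⟧))
    split (no _)   = sym (*-zeroʳ ⟦ S m ⟧)

  ∣f₃∣≤1 : ∀ m → ∣ f₃ f m ∣ ≤ 1ℚ
  ∣f₃∣≤1 m with does (m % 3 ℕ.≟ 1)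
  ... | true  = ≤-reflexive ∣⟦ f m ⟧∣≡1
  ... | false = 0≤⟪ 1 ⟫

  -- The limit is exactly 1/3 for each positive window length, divisible by 3 or not: any three
  -- consecutive windows see each offset in all three residue classes, so their model values add up
  -- to 1.
  f-windows : ∀ k → ConvergesTo (inner f (suc k)) ⅓
  f-windows k = average-limit (λ n → ∣ g n ∣) h ⅓ (changes S H) (changes-null S S-suc H)
    (λ n → close-off (changes S H (suc n)) (∣ g (suc n) ∣ - h (suc n))
      (∣p-q∣≤2 ∣ g (suc n) ∣ (h (suc n))
        (subst (_≤ 1ℚ) (sym (∣∣p∣∣≡∣p∣ (g (suc n)))) (∣avg∣≤1 k λ i → ∣f₃∣≤1 (suc n ℕ.+ i))) (∣h∣≤1 (suc n)))
      λ ok → trans (cong (λ z → z - h (suc n)) (steady (suc n) ok)) (+-inverseʳ (h (suc n))))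
    4 (block-sums-bounded (λ n → h n - ⅓)
        (λ j → centred-block ⅓ (h (1 ℕ.+ j ℕ.* 3)) (h (2 ℕ.+ j ℕ.* 3)) (h (3 ℕ.+ j ℕ.* 3)) (block (1 ℕ.+ j ℕ.* 3)) refl)
        λ n → ∣p-q∣≤2 (h n) ⅓ (∣h∣≤1 n) (≤ᵇ⇒≤ {∣ ⅓ ∣} {1ℚ} _))
    where
    H = suc k
    g h : ℕ → ℚ
    g n = avg H (λ i → f₃ f (n ℕ.+ i))
    h n = avg H (λ i → w (n ℕ.+ i))
    ∣h∣≤1 : ∀ n → ∣ h n ∣ ≤ 1ℚ
    ∣h∣≤1 n = ∣avg∣≤1 k λ i → w≤1 (n ℕ.+ i)
    0≤h : ∀ n → 0ℚ ≤ h n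
    0≤h n = subst (_≤ h n) (avg-const k 0ℚ) (avg-mono k λ i → 0≤w (n ℕ.+ i))
    block : ∀ n → h n + h (1 ℕ.+ n) + h (2 ℕ.+ n) ≡ 1ℚ
    block n = begin
      h n + h (1 ℕ.+ n) + h (2 ℕ.+ n)
        ≡⟨ trans (avg-+ H (λ i → w (n ℕ.+ i) + w (1 ℕ.+ n ℕ.+ i)) (λ i → w (2 ℕ.+ n ℕ.+ i))) (cong (_+ h (2 ℕ.+ n)) (avg-+ H _ _)) ⟨
      avg H (λ i → w (n ℕ.+ i) + w (1 ℕ.+ n ℕ.+ i) + w (2 ℕ.+ n ℕ.+ i))
        ≡⟨ avg-cong H (λ i _ → w-sum (n ℕ.+ i)) ⟩
      avg H (λ _ → 1ℚ)
        ≡⟨ avg-const k 1ℚ ⟩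
      1ℚ ∎
      where open ≡-Reasoning
    steady : ∀ n → changes S H n ≡ false → ∣ g n ∣ ≡ h n
    steady n ok = begin
      ∣ g n ∣
        ≡⟨ cong ∣_∣ (avg-cong H λ i i≤H → trans (f₃≡ (n ℕ.+ i)) (cong (λ s → ⟦ s ⟧ * w (n ℕ.+ i))
             (trans (cong S (ℕ.+-comm n i)) (unchanged S H n ok i i≤H)))) ⟩
      ∣ avg H (λ i → ⟦ S n ⟧ * w (n ℕ.+ i)) ∣    ≡⟨ cong ∣_∣ (avg-*ˡ H ⟦ S n ⟧ _) ⟩
      ∣ ⟦ S n ⟧ * h n ∣                          ≡⟨ ∣p*q∣≡∣p∣*∣q∣ ⟦ S n ⟧ (h n) ⟩
      ∣ ⟦ S n ⟧ ∣ * ∣ h n ∣                      ≡⟨ cong₂ _*_ ∣⟦ S n ⟧∣≡1 (0≤p⇒∣p∣≡p (0≤h n)) ⟩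
      1ℚ * h n                                   ≡⟨ *-identityˡ (h n) ⟩
      h n                                        ∎
      where open ≡-Reasoning

  -- `IteratedLimit` asks for a Cauchy sequence at `H = 0` too, where `avg` takes its conventional
  -- value 0.
  f-empty-windows : ConvergesTo (inner f 0) 0ℚ
  f-empty-windows = average-limit (λ _ → 0ℚ) (λ _ → 0ℚ) 0ℚ (λ _ → false) null-none
    (λ _ → close-off false 0ℚ 0≤⟪ 2 ⟫ λ _ → refl)
    0 (λ x → ≤-reflexive (cong ∣_∣ (trans (sumTo-const x 0ℚ) (*-zeroʳ ⟪ x ⟫))))

  p≤∣p∣ : ∀ p → p ≤ ∣ p ∣
  p≤∣p∣ p with ≤-total 0ℚ p
  ... | inj₁ 0≤p = ≤-reflexive (sym (0≤p⇒∣p∣≡p 0≤p))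
  ... | inj₂ p≤0 = ≤-trans p≤0 (0≤∣p∣ p)

  below-limit : ∀ a L δ → ∣ a - L ∣ < δ → a < L + δ
  below-limit a L δ lt = begin-strict
    a                 ≡⟨ +-identityʳ a ⟨
    a + 0ℚ            ≡⟨ cong (λ z → a + z) (+-inverseˡ L) ⟨
    a + (- L + L)     ≡⟨ +-assoc a (- L) L ⟨
    a - L + L         ≤⟨ +-monoˡ-≤ L (p≤∣p∣ (a - L)) ⟩
    ∣ a - L ∣ + L     <⟨ +-monoˡ-< L lt ⟩
    δ + L             ≡⟨ +-comm δ L ⟩
    L + δ             ∎
    where open ≤-Reasoning

open import Data.Nat using (ℕ; _≥_)
open import Data.Nat.Primality using (Prime)
open import Data.Integer using (+_)
open import Data.Rational using (ℚ; 0ℚ; _<_; -_; _/_)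
open import Data.Sign using (Sign)
open import Data.Product using (Σ; ∃; _×_)
open import Data.Nat using (zero; suc)
open import Data.Rational.Properties using (positive⁻¹)
open Averages using (f; ⅓; f-dilate; f-correlation; f-windows; f-empty-windows; convergent⇒Cauchy; below-limit)

theorem1p8 : Σ (ℕ → Sign) λ f →
    (∀ p → Prime p → Density0 (badSet f p))
    × (Σ ℚ λ ε → 0ℚ < ε × ∃ λ X → ∀ x → x ≥ X →
    avg x (λ n → ⟦ f n ⟧ Data.Rational.* ⟦ f (n Data.Nat.+ 1) ⟧) < - ε)
    × IteratedLimit (inner f) (+ 1 / 3)
theorem1p8 =
    f
  , (λ p pp → f-dilate pp)
  -- The correlation tends to -1/3, and -1/3 + 1/12 = -1/4.
  , (+ 1 / 4 , positive⁻¹ (+ 1 / 4) , proj₁ limit , λ x x≥ → below-limit _ (- ⅓) (+ 1 / 12) (proj₂ limit x x≥))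
  , (λ { zero    → convergent⇒Cauchy (inner f 0) 0ℚ f-empty-windows
       ; (suc k) → convergent⇒Cauchy (inner f (suc k)) ⅓ (f-windows k) })
  -- Every positive window length already has inner limit 1/3, so 1 serves as the bound on `H` for
  -- all `ε`.
  , (λ ε 0<ε → 1 , λ { (suc k) _ → f-windows k ε 0<ε })
  where
  limit = f-correlation (+ 1 / 12) (positive⁻¹ (+ 1 / 12))
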